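{- For every integer $s\geq 2$ there is a constant $C_s$ depending only on $s$ such that for all integers $t\geq 2$, $r\geq 3$ and every positive integer $n$, $$\mathrm{ex}(n,K_{s,t}^{(r)})\leq C_{s}\, t^{\frac{1}{s-1}}n^{r-\frac{1}{s-1}}.$$ In particular, there is an absolute constant $C$ such that $\mathrm{ex}(n,K_{2,t}^{(3)})\leq Ctn^2$ for all $t\ge 2$ and all $n$.
   Context: For an $r$-uniform hypergraph $H$, $\mathrm{ex}(n,H)$ denotes the largest number of edges in an $r$-uniform hypergraph on $n$ vertices containing no copy of $H$ (as a not necessarily induced subhypergraph). For positive integers $r,s,t$, $K_{s,t}^{(r)}$ denotes the $r$-uniform hypergraph whose vertex set is the union of pairwise disjoint sets $X,Y_1,\dots,Y_t$ with $|X|=s$ and $|Y_1|=\dots=|Y_t|=r-1$, and whose edge set is $\{\{x\}\cup Y_i : x\in X,\ 1\leq i\leq t\}$. -}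

module Defs where

open import Data.Bool.Properties using () renaming (_≟_ to _≟ᵇ_)
open import Data.Fin.Base using (Fin; zero; suc; _↑ˡ_; _↑ʳ_; splitAt; combine; funToFin; finToFun)
open import Data.Fin.Properties
  using (any?; all?; _≟_; suc-injective; ↑ʳ-injective; combine-injectiveʳ; finToFun-funToFin;
         splitAt-↑ˡ; splitAt-↑ʳ)
open import Data.Fin.Subset using (Subset; inside; outside; ⊤; ⊥; ⁅_⁆; _∪_; _∈_; _∉_; ∣_∣)
open import Data.Fin.Subset.Properties
  using (∉⊥; x∈⁅x⁆; x∈⁅y⁆⇒x≡y; x∈p∪q⁻; x∈p∪q⁺; ∣⊥∣≡0; ∣⊤∣≡n; ∪-identityˡ)
open import Data.List.Base
  using (List; []; _∷_; _++_; map; filter; length; allFin; cartesianProductWith; deduplicate)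
open import Data.List.Extrema.Nat using (max; xs≤max; argmax-sel)
open import Data.List.Membership.Propositional using () renaming (_∈_ to _∈ˡ_)
open import Data.List.Membership.DecPropositional using () renaming (_∈?_ to member?)
open import Data.List.Membership.Propositional.Properties
  using (∈-map⁺; ∈-map⁻; ∈-++⁺ˡ; ∈-++⁺ʳ; ∈-++⁻; ∈-filter⁺; ∈-filter⁻; ∈-cartesianProductWith⁻)
open import Data.List.Relation.Unary.All as All using (All; []; _∷_)
import Data.List.Relation.Unary.All.Properties as All
open import Data.List.Relation.Unary.Any using (here; there)
open import Data.List.Relation.Unary.AllPairs using ([]; _∷_)
open import Data.List.Relation.Unary.Unique.Propositional using (Unique)
import Data.List.Relation.Unary.Unique.Propositional.Properties as Unique
open import Data.List.Relation.Unary.Unique.DecPropositional.Properties using (deduplicate-!)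
open import Data.Nat.Base using (ℕ; zero; suc; _+_; _*_; _^_; _≤_; z≤n; s≤s; pred; NonZero)
open import Data.Nat.Properties using (≤-trans; ≤-reflexive; n≤0⇒n≡0; suc-pred) renaming (_≟_ to _≟ⁿ_)
open import Data.Product.Base using (∃-syntax; _×_; _,_; proj₁; proj₂)
open import Data.Sum.Base using (inj₁; inj₂)
open import Data.Vec.Base using ([]; _∷_; here; there)
open import Data.Vec.Properties using (≡-dec; ∷-injectiveʳ)
open import Function.Base using (_∘_; id)
open import Function.Definitions using (Injective)
open import Relation.Binary.Definitions using (DecidableEquality)
open import Relation.Binary.PropositionalEquality
open import Relation.Nullary.Decidable using (Dec; yes; no; map′; ¬?; _×-dec_; _→-dec_)
open import Relation.Nullary.Negation using (¬_; contradiction)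

private
  variable
    m n : ℕ

_≟ˢ_ : DecidableEquality (Subset n)
_≟ˢ_ = ≡-dec _≟ᵇ_

image : (Fin m → Fin n) → Subset m → Subset n
image f []            = ⊥
image f (inside  ∷ p) = ⁅ f zero ⁆ ∪ image (f ∘ suc) p
image f (outside ∷ p) = image (f ∘ suc) p

∈-image⁺ : ∀ (f : Fin m → Fin n) {p x} → x ∈ p → f x ∈ image f p
∈-image⁺ f {inside  ∷ p} here        = x∈p∪q⁺ (inj₁ (x∈⁅x⁆ (f zero)))
∈-image⁺ f {inside  ∷ p} (there x∈p) = x∈p∪q⁺ (inj₂ (∈-image⁺ (f ∘ suc) x∈p))
∈-image⁺ f {outside ∷ p} (there x∈p) = ∈-image⁺ (f ∘ suc) x∈p

∈-image⁻ : ∀ (f : Fin m → Fin n) p {y} → y ∈ image f p → ∃[ x ] (x ∈ p × f x ≡ y)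
∈-image⁻ f []            y∈ = contradiction y∈ ∉⊥
∈-image⁻ f (inside  ∷ p) y∈ with x∈p∪q⁻ ⁅ f zero ⁆ (image (f ∘ suc) p) y∈
... | inj₁ y∈₁ = zero , here , sym (x∈⁅y⁆⇒x≡y _ y∈₁)
... | inj₂ y∈₂ with x , x∈p , fx≡y ← ∈-image⁻ (f ∘ suc) p y∈₂ = suc x , there x∈p , fx≡y
∈-image⁻ f (outside ∷ p) y∈ with x , x∈p , fx≡y ← ∈-image⁻ (f ∘ suc) p y∈ = suc x , there x∈p , fx≡y

image-cong : ∀ {f g : Fin m → Fin n} → f ≗ g → image f ≗ image g
image-cong f≗g []            = refl
image-cong f≗g (inside  ∷ p) = cong₂ _∪_ (cong ⁅_⁆ (f≗g zero)) (image-cong (f≗g ∘ suc) p)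
image-cong f≗g (outside ∷ p) = image-cong (f≗g ∘ suc) p

∣⁅x⁆∪p∣ : ∀ {x} {p : Subset n} → x ∉ p → ∣ ⁅ x ⁆ ∪ p ∣ ≡ suc ∣ p ∣
∣⁅x⁆∪p∣ {x = zero}  {inside  ∷ p} x∉p = contradiction here x∉p
∣⁅x⁆∪p∣ {x = zero}  {outside ∷ p} x∉p = cong (suc ∘ ∣_∣) (∪-identityˡ p)
∣⁅x⁆∪p∣ {x = suc x} {inside  ∷ p} x∉p = cong suc (∣⁅x⁆∪p∣ (x∉p ∘ there))
∣⁅x⁆∪p∣ {x = suc x} {outside ∷ p} x∉p = ∣⁅x⁆∪p∣ (x∉p ∘ there)

∣image∣ : ∀ {f : Fin m → Fin n} → Injective _≡_ _≡_ f → ∀ p → ∣ image f p ∣ ≡ ∣ p ∣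
∣image∣ {n = n} inj []            = ∣⊥∣≡0 n
∣image∣ {f = f} inj (inside  ∷ p) =
  trans (∣⁅x⁆∪p∣ f0∉) (cong suc (∣image∣ (suc-injective ∘ inj) p))
  where
  f0∉ : f zero ∉ image (f ∘ suc) p
  f0∉ f0∈ with x , _ , eq ← ∈-image⁻ (f ∘ suc) p f0∈ = contradiction (inj eq) λ ()
∣image∣ inj (outside ∷ p) = ∣image∣ (suc-injective ∘ inj) p

record Hypergraph (r n : ℕ) : Set where
  field
    edges   : List (Subset n)
    uniform : All (λ e → ∣ e ∣ ≡ r) edges
    unique  : Unique edges

  size : ℕ
  size = length edges

open Hypergraph public using (edges; uniform; unique; size)

-- E ⊑ F: the edge family F contains a (not necessarily induced) copy of E.
infix 4 _⊑_ _⊑?_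

_⊑_ : List (Subset m) → List (Subset n) → Set
_⊑_ {m} {n} E F =
  ∃[ f ] (Injective {A = Fin m} {B = Fin n} _≡_ _≡_ f × All (λ e → image f e ∈ˡ F) E)

_⊑?_ : (E : List (Subset m)) (F : List (Subset n)) → Dec (E ⊑ F)
_⊑?_ {m} {n} E F = map′
  (λ (i , c) → finToFun i , c)
  (λ (f , inj , c) → funToFin f
    , (λ {x} {y} eq → inj (trans (sym (finToFun-funToFin f x)) (trans eq (finToFun-funToFin f y))))
    , All.map (λ {e} → subst (_∈ˡ F) (sym (image-cong (finToFun-funToFin f) e))) c)
  (any? (λ i → copy? (finToFun i)))
  where
  copy? : (f : Fin m → Fin n) → Dec (Injective _≡_ _≡_ f × All (λ e → image f e ∈ˡ F) E)
  copy? f =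
    map′ (λ h {x} {y} → h x y) (λ h x y → h {x} {y})
      (all? λ x → all? λ y → (f x ≟ f y) →-dec (x ≟ y))
    ×-dec All.all? (λ e → member? _≟ˢ_ (image f e) F) E

Free : ∀ {r} → Hypergraph r m → Hypergraph r n → Set
Free H G = ¬ (edges H ⊑ edges G)

subsets : ∀ n → List (Subset n)
subsets zero    = [] ∷ []
subsets (suc n) = map (outside ∷_) (subsets n) ++ map (inside ∷_) (subsets n)

sublists : {A : Set} → List A → List (List A)
sublists []       = [] ∷ []
sublists (x ∷ xs) = sublists xs ++ map (x ∷_) (sublists xs)

rsets : ∀ r n → List (Subset n)
rsets r n = filter (λ e → ∣ e ∣ ≟ⁿ r) (subsets n)

freeFamilies : ∀ {r} n → Hypergraph r m → List (List (Subset n))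
freeFamilies {r = r} n H = filter (λ F → ¬? (edges H ⊑? F)) (sublists (rsets r n))

-- The value is 0 if no r-uniform hypergraph on n vertices is H-free, which can
-- only happen when H has no edges.
ex : ∀ {r} → ℕ → Hypergraph r m → ℕ
ex n H = max 0 (map length (freeFamilies n H))

-- The following lemmas show that ex n H is the maximum: an upper bound
-- (ex-upper) that is attained (ex-attained).

∈-subsets : (p : Subset n) → p ∈ˡ subsets n
∈-subsets []            = here refl
∈-subsets (outside ∷ p) = ∈-++⁺ˡ (∈-map⁺ _ (∈-subsets p))
∈-subsets (inside  ∷ p) = ∈-++⁺ʳ _ (∈-map⁺ _ (∈-subsets p))

subsets-unique : ∀ n → Unique (subsets n)
subsets-unique zero    = [] ∷ []
subsets-unique (suc n) = Unique.++⁺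
  (Unique.map⁺ ∷-injectiveʳ (subsets-unique n))
  (Unique.map⁺ ∷-injectiveʳ (subsets-unique n))
  λ (p∈₁ , p∈₂) → disjoint (∈-map⁻ _ p∈₁) (∈-map⁻ _ p∈₂)
  where
  disjoint : ∀ {p : Subset (suc n)} {P Q : Subset n → Set} →
             ∃[ q ] (P q × p ≡ outside ∷ q) → ¬ (∃[ q ] (Q q × p ≡ inside ∷ q))
  disjoint (_ , _ , refl) (_ , _ , ())

module _ {A : Set} where

  filter∈sublists : ∀ {P : A → Set} (P? : ∀ x → Dec (P x)) xs → filter P? xs ∈ˡ sublists xs
  filter∈sublists P? []       = here refl
  filter∈sublists P? (x ∷ xs) with P? x
  ... | yes _ = ∈-++⁺ʳ (sublists xs) (∈-map⁺ (x ∷_) (filter∈sublists P? xs))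
  ... | no  _ = ∈-++⁺ˡ (filter∈sublists P? xs)

  sublists-All : ∀ {P : A → Set} {xs ys} → ys ∈ˡ sublists xs → All P xs → All P ys
  sublists-All {xs = []}     (here refl) []        = []
  sublists-All {xs = x ∷ xs} ys∈         (px ∷ ps) with ∈-++⁻ (sublists xs) ys∈
  ... | inj₁ ys∈₁ = sublists-All ys∈₁ ps
  ... | inj₂ ys∈₂ with _ , zs∈ , refl ← ∈-map⁻ (x ∷_) ys∈₂ = px ∷ sublists-All zs∈ ps

  sublists-Unique : ∀ {xs ys : List A} → ys ∈ˡ sublists xs → Unique xs → Unique ys
  sublists-Unique {xs = []}     (here refl) []       = []
  sublists-Unique {xs = x ∷ xs} ys∈         (p ∷ ps) with ∈-++⁻ (sublists xs) ys∈
  ... | inj₁ ys∈₁ = sublists-Unique ys∈₁ ps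
  ... | inj₂ ys∈₂ with _ , zs∈ , refl ← ∈-map⁻ (x ∷_) ys∈₂ =
    sublists-All zs∈ p ∷ sublists-Unique zs∈ ps

  remove : ∀ {x : A} {ys} → x ∈ˡ ys → List A
  remove {ys = y ∷ ys} (here _)  = ys
  remove {ys = y ∷ ys} (there i) = y ∷ remove i

  length-remove : ∀ {x : A} {ys} (i : x ∈ˡ ys) → length ys ≡ suc (length (remove i))
  length-remove (here _)  = refl
  length-remove (there i) = cong suc (length-remove i)

  ∈-remove : ∀ {x z : A} {ys} (i : x ∈ˡ ys) → ¬ (x ≡ z) → z ∈ˡ ys → z ∈ˡ remove i
  ∈-remove (here refl) x≢z (here refl) = contradiction refl x≢z
  ∈-remove (here refl) x≢z (there j)   = j
  ∈-remove (there i)   x≢z (here refl) = here refl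
  ∈-remove (there i)   x≢z (there j)   = there (∈-remove i x≢z j)

  length-mono : ∀ {xs ys : List A} → Unique xs → (∀ {z} → z ∈ˡ xs → z ∈ˡ ys) → length xs ≤ length ys
  length-mono []       xs⊆ys = z≤n
  length-mono {x ∷ xs} (p ∷ ps) xs⊆ys = ≤-trans
    (s≤s (length-mono ps λ z∈ → ∈-remove (xs⊆ys (here refl)) (All.lookup p z∈) (xs⊆ys (there z∈))))
    (≤-reflexive (sym (length-remove (xs⊆ys (here refl)))))

module _ {r} {H : Hypergraph r m} where

  ex-upper : (G : Hypergraph r n) → Free H G → size G ≤ ex n H
  ex-upper {n} G free = ≤-trans
    (length-mono (unique G) λ e∈ → ∈-filter⁺ inG? (∈-filter⁺ _ (∈-subsets _) (All.lookup (uniform G) e∈)) e∈)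
    (All.lookup (xs≤max 0 (map length (freeFamilies n H)))
      (∈-map⁺ length (∈-filter⁺ _ (filter∈sublists inG? (rsets r n)) F-free)))
    where
    inG? : ∀ e → Dec (e ∈ˡ edges G)
    inG? e = member? _≟ˢ_ e (edges G)

    F-free : ¬ (edges H ⊑ filter inG? (rsets r n))
    F-free (f , inj , c) = free (f , inj , All.map (proj₂ ∘ ∈-filter⁻ inG? {xs = rsets r n}) c)

  ex-attained : ∀ (G₀ : Hypergraph r n) → Free H G₀ → ∃[ G ] (Free H G × size {r} {n} G ≡ ex n H)
  ex-attained {n} G₀ free₀ with argmax-sel id 0 (map length (freeFamilies n H))
  ... | inj₁ ex≡0 =
    G₀ , free₀ , trans (n≤0⇒n≡0 (subst (size G₀ ≤_) ex≡0 (ex-upper G₀ free₀))) (sym ex≡0)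
  ... | inj₂ ex∈ with F , F∈ , ex≡ ← ∈-map⁻ length ex∈
    with F∈′ , F-free ← ∈-filter⁻ (λ F → ¬? (edges H ⊑? F)) {xs = sublists (rsets r n)} F∈ =
    record
      { edges   = F
      ; uniform = sublists-All F∈′ (All.all-filter _ (subsets n))
      ; unique  = sublists-Unique F∈′ (Unique.filter⁺ _ (subsets-unique n))
      } , F-free , sym ex≡

-- The vertex set of K s t r is Fin (s + t * (r - 1)): the first s vertices form
-- X, followed by t consecutive blocks Y₁, …, Y_t of r - 1 vertices each.
module _ (s t r : ℕ) where

  xVertex : Fin s → Fin (s + t * pred r)
  xVertex x = x ↑ˡ (t * pred r)

  yVertex : Fin t → Fin (pred r) → Fin (s + t * pred r)
  yVertex i j = s ↑ʳ combine i j

  Y : Fin t → Subset (s + t * pred r)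
  Y i = image (yVertex i) ⊤

  edge : Fin s → Fin t → Subset (s + t * pred r)
  edge x i = ⁅ xVertex x ⁆ ∪ Y i

  ∣edge∣ : .{{_ : NonZero r}} → ∀ x i → ∣ edge x i ∣ ≡ r
  ∣edge∣ x i = trans (∣⁅x⁆∪p∣ x∉Y)
    (trans (cong suc (trans (∣image∣ yInj ⊤) (∣⊤∣≡n (pred r)))) (suc-pred r))
    where
    yInj : Injective _≡_ _≡_ (yVertex i)
    yInj {j} {k} eq = combine-injectiveʳ i j i k (↑ʳ-injective s _ _ eq)

    x∉Y : xVertex x ∉ Y i
    x∉Y x∈ with j , _ , eq ← ∈-image⁻ (yVertex i) ⊤ x∈
      with () ← trans (sym (splitAt-↑ʳ s (t * pred r) (combine i j)))
                      (trans (cong (splitAt s) eq) (splitAt-↑ˡ s x (t * pred r)))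

  -- Deduplication only has an effect for r = 1, where all Y i are empty.
  K : .{{_ : NonZero r}} → Hypergraph r (s + t * pred r)
  K = record
    { edges   = deduplicate _≟ˢ_ allEdges
    ; uniform = All.deduplicate⁺ _≟ˢ_ (All.tabulate λ e∈ →
        let x , i , _ , _ , eq = ∈-cartesianProductWith⁻ edge (allFin s) (allFin t) e∈
        in trans (cong ∣_∣ eq) (∣edge∣ x i))
    ; unique  = deduplicate-! _≟ˢ_ allEdges
    }
    where
    allEdges : List (Subset (s + t * pred r))
    allEdges = cartesianProductWith edge (allFin s) (allFin t)

-- For an (r-1)-set p let deg p be the number of edges p ∪ {x}. Call x a top of p
-- if p has the largest degree among the (r-1)-subsets of the edge p ∪ {x}; every
-- edge arises in this way, so |F| is at most the number of pairs (x, p) with x a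
-- top of p. Give each triple of a pair (x, p) and an s-tuple S of distinct
-- neighbours of p ending in x the weight 1 / deg p. For fixed S the common link has no t
-- disjoint sets, so it is covered by t(r-1) vertices y; each p in it is {y, z} ∪ W,
-- and because deg ({x, y} ∪ W) ≤ deg p the weights sum to at most 1 over z. Hence
-- the total weight is O(t n^{r+s-3}). On the other hand each p contributes about
-- (number of tops) * (deg p)^{s-2}, at least (number of tops)^{s-1}, and the power
-- mean inequality finishes the proof. To stay in ℕ, all weights are scaled by n!.
module Submission where

open import Data.Nat using (ℕ; _+_; _*_; _∸_; _^_; _≤_; NonZero)
open import Data.Product using (∃-syntax; _×_)
open import Defs

open import Data.Fin.Base using (Fin; zero; suc; splitAt; combine; remQuot; inject≤; _↑ʳ_)
import Data.Fin.Properties as Fin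
open import Data.Fin.Subset
  using (Subset; ⊥; ⊤; _─_; inside; outside; ⁅_⁆; _∪_; _∩_; _∈_; _∉_; _-_; ∣_∣; _⊆_; Nonempty)
open import Data.Fin.Subset.Properties
  using (_∈?_; ∣⊥∣≡0; x∈⁅x⁆; x∈⁅y⁆⇒x≡y; x∈p∪q⁻; x∈p∪q⁺; x∈p∩q⁻; x∈p∩q⁺; p─q⊆p; ⊆-antisym;
         x∈p∧x≢y⇒x∈p-y; ∪-assoc; ∪-comm; ∩-comm; ∈⊤; nonempty?)
open import Data.List.Base
  using (List; []; _∷_; _++_; map; length; filter; lookup; allFin; cartesianProduct; cartesianProductWith)
open import Data.List.Extrema.Nat using (argmax; argmax-sel; f[xs]≤f[argmax])
open import Data.List.Membership.DecPropositional using () renaming (_∈?_ to member?)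
open import Data.List.Membership.Propositional using (find) renaming (_∈_ to _∈ˡ_)
open import Data.List.Membership.Propositional.Properties
  using (∈-filter⁺; ∈-filter⁻; ∈-map⁺; ∈-map⁻; ∈-++⁺ˡ; ∈-++⁺ʳ; ∈-allFin; ∈-lookup; ∈-cartesianProduct⁺;
         ∈-cartesianProductWith⁻)
open import Data.List.Properties using (map-++; map-∘; length-++; length-map; length-tabulate; filter-++)
open import Data.List.Relation.Unary.All as All using ([]; _∷_)
import Data.List.Relation.Unary.All.Properties as All
open import Data.List.Relation.Unary.AllPairs using (AllPairs; []; _∷_)
open import Data.List.Relation.Unary.Any using (Any; any?; here; there)
open import Data.List.Relation.Unary.Unique.Propositional using (Unique)
import Data.List.Relation.Unary.Unique.Propositional.Properties as Unique
open import Data.Nat using (zero; suc; z≤n; s≤s; _<_; _/_; _!; >-nonZero)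
open import Data.Nat.Divisibility using (m∣m*n; ∣-trans; m≤n⇒m!∣n!)
open import Data.Nat.DivMod using (m/n*n≡m; m/n*n≤m; /-monoʳ-≤)
open import Data.Nat.ListAction using (sum)
open import Data.Nat.ListAction.Properties using (sum-++)
open import Data.Nat.Properties
open import Data.Nat.Tactic.RingSolver using (solve-∀)
open import Data.Product using (_,_; proj₁; proj₂; uncurry)
open import Data.Sum using (_⊎_; inj₁; inj₂; [_,_]′)
open import Data.Vec.Base as Vec using (Vec; []; _∷_; here; there; toList)
open import Data.Vec.Membership.DecPropositional using () renaming (_∈?_ to memberᵛ?)
open import Data.Vec.Membership.Propositional using () renaming (_∈_ to _∈ᵛ_)
open import Data.Vec.Membership.Propositional.Properties using (∈-toList⁺) renaming (∈-lookup to ∈ᵛ-lookup)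
open import Data.Vec.Properties using (length-toList)
open import Data.Vec.Relation.Unary.All as VecAll using ([]; _∷_)
import Data.Vec.Relation.Unary.All.Properties as VecAll
open import Data.Vec.Relation.Unary.AllPairs as VecPairs using ([]; _∷_)
import Data.Vec.Relation.Unary.Unique.Propositional as Vec
import Data.Vec.Relation.Unary.Unique.Propositional.Properties as VecUnique
open import Function using (_∘_; id; case_of_)
open import Function.Definitions using (Injective)
open import Relation.Binary.Definitions using (Symmetric)
open import Relation.Binary.PropositionalEquality
open import Relation.Nullary using (Dec; yes; no; ¬_; contradiction)
open import Relation.Nullary.Decidable using (_×-dec_; _→-dec_; ¬?)

private
  variable
    n : ℕ
    A B C : Set
    xs : List A
    f g : A → ℕ

-- Finite sums over lists.

∑ : List A → (A → ℕ) → ℕ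
∑ xs f = sum (map f xs)

∑-mono : (∀ {x} → x ∈ˡ xs → f x ≤ g x) → ∑ xs f ≤ ∑ xs g
∑-mono {xs = []}     f≤g = z≤n
∑-mono {xs = x ∷ xs} f≤g = +-mono-≤ (f≤g (here refl)) (∑-mono (f≤g ∘ there))

∑-cong : f ≗ g → ∑ xs f ≡ ∑ xs g
∑-cong {xs = []}     f≗g = refl
∑-cong {xs = x ∷ xs} f≗g = cong₂ _+_ (f≗g x) (∑-cong {xs = xs} f≗g)

∑-distrib-+ : ∀ (xs : List A) f g → ∑ xs (λ x → f x + g x) ≡ ∑ xs f + ∑ xs g
∑-distrib-+ []       f g = refl
∑-distrib-+ (x ∷ xs) f g rewrite ∑-distrib-+ xs f g =
  interchange (f x) (g x) (∑ xs f) (∑ xs g)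
  where
  interchange : ∀ a b c d → a + b + (c + d) ≡ a + c + (b + d)
  interchange = solve-∀

∑-distribˡ-* : ∀ c (xs : List A) f → ∑ xs (λ x → c * f x) ≡ c * ∑ xs f
∑-distribˡ-* c []       f = sym (*-zeroʳ c)
∑-distribˡ-* c (x ∷ xs) f rewrite ∑-distribˡ-* c xs f = sym (*-distribˡ-+ c (f x) _)

∑-const : ∀ (xs : List A) c → ∑ xs (λ _ → c) ≡ length xs * c
∑-const []       c = refl
∑-const (x ∷ xs) c = cong (c +_) (∑-const xs c)

∑-≤-const : ∀ {c} → (∀ {x} → x ∈ˡ xs → f x ≤ c) → ∑ xs f ≤ length xs * c
∑-≤-const {xs = xs} f≤c = ≤-trans (∑-mono f≤c) (≤-reflexive (∑-const xs _))

∑-swap : ∀ (xs : List A) (ys : List B) (f : A → B → ℕ) →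
         ∑ xs (λ x → ∑ ys (f x)) ≡ ∑ ys (λ y → ∑ xs (λ x → f x y))
∑-swap []       ys f = sym (trans (∑-const ys 0) (*-zeroʳ (length ys)))
∑-swap (x ∷ xs) ys f rewrite ∑-swap xs ys f = sym (∑-distrib-+ ys (f x) _)

∑-++ : ∀ (xs ys : List A) f → ∑ (xs ++ ys) f ≡ ∑ xs f + ∑ ys f
∑-++ xs ys f = trans (cong sum (map-++ f xs ys)) (sum-++ (map f xs) (map f ys))

∑-map : ∀ (h : A → B) xs f → ∑ (map h xs) f ≡ ∑ xs (f ∘ h)
∑-map h xs f = cong sum (sym (map-∘ xs))

∑-cartesianProductWith : ∀ (h : A → B → C) as bs f →
  ∑ (cartesianProductWith h as bs) f ≡ ∑ as (λ a → ∑ bs (λ b → f (h a b)))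
∑-cartesianProductWith h []       bs f = refl
∑-cartesianProductWith h (a ∷ as) bs f = trans
  (∑-++ (map (h a) bs) (cartesianProductWith h as bs) f)
  (cong₂ _+_ (∑-map (h a) bs f) (∑-cartesianProductWith h as bs f))

∑-remove : ∀ {x : A} {xs} (i : x ∈ˡ xs) f → ∑ xs f ≡ f x + ∑ (remove i) f
∑-remove (here refl) f = refl
∑-remove {x = x} {y ∷ ys} (there i) f rewrite ∑-remove i f =
  rotate (f y) (f x) (∑ (remove i) f)
  where
  rotate : ∀ a b c → a + (b + c) ≡ b + (a + c)
  rotate = solve-∀

-- Each entry `x` with positive `f x` is charged to a key `k` with `h k ≡ x`. Since `h` is a
-- function, distinct entries have distinct keys, so a key can be removed from `ks` once it has been
-- used. Entries of value zero need no key.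
∑-cover : ∀ {f : A → ℕ} {g : B → ℕ} (h : B → A) {xs ks} → Unique xs →
          (∀ {x} → x ∈ˡ xs → 0 < f x → ∃[ k ] (k ∈ˡ ks × h k ≡ x × f x ≤ g k)) →
          ∑ xs f ≤ ∑ ks g
∑-cover h {[]} _ covered = z≤n
∑-cover {f = f} {g} h {x ∷ xs} (x∉xs ∷ xs!) covered with f x in fx≡
... | zero = ∑-cover h xs! (covered ∘ there)
... | suc _ with k , k∈ , refl , fx≤gk ← covered (here refl) (subst (0 <_) (sym fx≡) (s≤s z≤n)) =
  ≤-trans
    (+-mono-≤ (subst (_≤ g k) fx≡ fx≤gk) (∑-cover h xs! λ y∈ 0<fy →
      let k′ , k′∈ , hk′≡y , fy≤gk′ = covered (there y∈) 0<fy
      in k′ , ∈-remove k∈ (λ k≡k′ → All.lookup x∉xs y∈ (trans (cong h k≡k′) hk′≡y)) k′∈ , hk′≡y , fy≤gk′))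
    (≤-reflexive (sym (∑-remove k∈ g)))

-- Iverson brackets of decidable propositions.

⟦_⟧ : Dec A → ℕ
⟦ yes _ ⟧ = 1
⟦ no  _ ⟧ = 0

⟦⟧-mono : (a? : Dec A) (b? : Dec B) → (A → B) → ⟦ a? ⟧ ≤ ⟦ b? ⟧
⟦⟧-mono (no _)  b?      a⇒b = z≤n
⟦⟧-mono (yes a) (yes _) a⇒b = ≤-refl
⟦⟧-mono (yes a) (no ¬b) a⇒b = contradiction (a⇒b a) ¬b

⟦⟧>0⇒ : (a? : Dec A) → 0 < ⟦ a? ⟧ → A
⟦⟧>0⇒ (yes a) _ = a

⟦⟧*⟦⟧*>0⇒ : (a? : Dec A) (b? : Dec B) {c : ℕ} → 0 < ⟦ a? ⟧ * (⟦ b? ⟧ * c) → A × B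
⟦⟧*⟦⟧*>0⇒ (yes a) (yes b) _ = a , b

⟦⟧-true : (a? : Dec A) → A → 1 ≤ ⟦ a? ⟧
⟦⟧-true (yes _) _ = ≤-refl
⟦⟧-true (no ¬a) a = contradiction a ¬a

⟦⟧-false : (a? : Dec A) → ¬ A → ⟦ a? ⟧ ≡ 0
⟦⟧-false (yes a) ¬a = contradiction a ¬a
⟦⟧-false (no  _) _  = refl

⟦⟧≤1 : (a? : Dec A) → ⟦ a? ⟧ ≤ 1
⟦⟧≤1 (yes _) = ≤-refl
⟦⟧≤1 (no  _) = z≤n

-- The power mean inequality.

-- Induction on the exponent: the extra factor `∑ xs f` is absorbed by Chebyshev's sum inequality,
-- applied to the similarly ordered sequences `f x` and `f x ^ suc k`.
power-mean : ∀ (xs : List A) f k → ∑ xs f ^ suc k ≤ length xs ^ k * ∑ xs (λ x → f x ^ suc k)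
power-mean xs f zero = ≤-reflexive (begin-equality
  ∑ xs f * 1                    ≡⟨ *-identityʳ _ ⟩
  ∑ xs f                        ≡⟨ ∑-cong {xs = xs} (λ x → *-identityʳ (f x)) ⟨
  ∑ xs (λ x → f x ^ 1)          ≡⟨ *-identityˡ _ ⟨
  1 * ∑ xs (λ x → f x ^ 1)      ∎)
  where open ≤-Reasoning
power-mean xs f (suc k) = begin
  S * S ^ suc k                        ≤⟨ *-monoʳ-≤ S (power-mean xs f k) ⟩
  S * (M ^ k * ∑ xs (λ x → f x ^ suc k)) ≡⟨ rotate S (M ^ k) _ ⟩
  M ^ k * (S * ∑ xs (λ x → f x ^ suc k)) ≤⟨ *-monoʳ-≤ (M ^ k) (chebyshev xs) ⟩
  M ^ k * (M * ∑ xs (λ x → f x ^ suc (suc k))) ≡⟨ trans (rotate (M ^ k) M _) (sym (*-assoc M (M ^ k) _)) ⟩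
  M ^ suc k * ∑ xs (λ x → f x ^ suc (suc k)) ∎
  where
  open ≤-Reasoning
  S = ∑ xs f
  M = length xs

  rotate : ∀ a b c → a * (b * c) ≡ b * (a * c)
  rotate = solve-∀

  -- With `b = a + d` and `b ^ suc k = a ^ suc k + e`, the two sides differ by exactly `d * e`.
  ordered : ∀ {a b} → a ≤ b → a * b ^ suc k + b * a ^ suc k ≤ a * a ^ suc k + b * b ^ suc k
  ordered {a} {b} a≤b with d , refl ← m≤n⇒∃[o]m+o≡n a≤b
    with e , b^≡ ← m≤n⇒∃[o]m+o≡n (^-monoˡ-≤ (suc k) a≤b) = begin
    a * (a + d) ^ suc k + (a + d) * a ^ suc k ≡⟨ cong (λ z → a * z + (a + d) * a ^ suc k) b^≡ ⟨
    a * (p + e) + (a + d) * p                 ≤⟨ m≤m+n _ (d * e) ⟩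
    a * (p + e) + (a + d) * p + d * e         ≡⟨ expand a d p e ⟩
    a * p + (a + d) * (p + e)                 ≡⟨ cong (λ z → a * p + (a + d) * z) b^≡ ⟩
    a * a ^ suc k + (a + d) * (a + d) ^ suc k ∎
    where
    p = a ^ suc k
    expand : ∀ a d p e → a * (p + e) + (a + d) * p + d * e ≡ a * p + (a + d) * (p + e)
    expand = solve-∀

  rearrange : ∀ a b → a * b ^ suc k + b * a ^ suc k ≤ a * a ^ suc k + b * b ^ suc k
  rearrange a b with ≤-total a b
  ... | inj₁ a≤b = ordered a≤b
  ... | inj₂ b≤a = subst₂ _≤_ (+-comm (b * a ^ suc k) _) (+-comm (b * b ^ suc k) _) (ordered b≤a)

  -- Induction on the list: expanding the product leaves, for each later entry `z`, the cross terms
  -- between `z` and the head `y`, which `rearrange` bounds pairwise.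
  chebyshev : ∀ ys → ∑ ys f * ∑ ys (λ y → f y ^ suc k) ≤ length ys * ∑ ys (λ y → f y ^ suc (suc k))
  chebyshev []       = z≤n
  chebyshev (y ∷ ys) = begin
    (a + P) * (q + Q)                                       ≡⟨ expand₁ a P q Q ⟩
    a * q + (a * Q + q * P) + P * Q                         ≡⟨ cong (λ z → a * q + z + P * Q) crossTerms ⟨
    a * q + ∑ ys (λ z → a * f z ^ suc k + f z * q) + P * Q  ≤⟨ +-mono-≤ (+-monoʳ-≤ (a * q) (∑-mono {xs = ys} λ {z} _ → rearrange a (f z))) (chebyshev ys) ⟩
    a * q + ∑ ys (λ z → a * q + f z * f z ^ suc k) + L * R  ≡⟨ cong (λ z → a * q + z + L * R) (trans (∑-distrib-+ ys _ _) (cong (_+ R) (∑-const ys (a * q)))) ⟩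
    a * q + (L * (a * q) + R) + L * R                       ≡⟨ expand₂ (a * q) L R ⟩
    suc L * (a * q + R)                                     ∎
    where
    a = f y
    q = f y ^ suc k
    P = ∑ ys f
    Q = ∑ ys (λ z → f z ^ suc k)
    R = ∑ ys (λ z → f z ^ suc (suc k))
    L = length ys

    expand₁ : ∀ a P q Q → (a + P) * (q + Q) ≡ a * q + (a * Q + q * P) + P * Q
    expand₁ = solve-∀

    expand₂ : ∀ c L R → c + (L * c + R) + L * R ≡ suc L * (c + R)
    expand₂ = solve-∀

    crossTerms : ∑ ys (λ z → a * f z ^ suc k + f z * q) ≡ a * Q + q * P
    crossTerms = trans (∑-distrib-+ ys _ _) (cong₂ _+_ (∑-distribˡ-* a ys _)
      (trans (∑-cong {xs = ys} λ z → *-comm (f z) q) (∑-distribˡ-* q ys f)))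

-- Counting the subsets of a given size.

length-filter-∑ : ∀ {P : A → Set} (P? : ∀ x → Dec (P x)) xs → length (filter P? xs) ≡ ∑ xs (λ x → ⟦ P? x ⟧)
length-filter-∑ P? []       = refl
length-filter-∑ P? (x ∷ xs) with P? x
... | yes _ = cong suc (length-filter-∑ P? xs)
... | no  _ = length-filter-∑ P? xs

length-filter-map : ∀ {P : A → Set} {Q : B → Set} (P? : ∀ x → Dec (P x)) (Q? : ∀ x → Dec (Q x)) (h : B → A) →
                    (∀ {x} → P (h x) → Q x) → (∀ {x} → Q x → P (h x)) →
                    ∀ xs → length (filter P? (map h xs)) ≡ length (filter Q? xs)
length-filter-map P? Q? h P⇒Q Q⇒P xs = begin
  length (filter P? (map h xs))      ≡⟨ length-filter-∑ P? (map h xs) ⟩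
  ∑ (map h xs) (λ x → ⟦ P? x ⟧)      ≡⟨ ∑-map h xs _ ⟩
  ∑ xs (λ x → ⟦ P? (h x) ⟧)          ≡⟨ ∑-cong {xs = xs} (λ x → ≤-antisym (⟦⟧-mono (P? _) (Q? x) P⇒Q) (⟦⟧-mono (Q? x) (P? _) Q⇒P)) ⟩
  ∑ xs (λ x → ⟦ Q? x ⟧)              ≡⟨ length-filter-∑ Q? xs ⟨
  length (filter Q? xs)              ∎
  where open ≡-Reasoning

-- Pascal's rule, read off from the order of `subsets`: first the sets avoiding vertex 0, then those
-- containing it.
length-rsets-suc : ∀ k n → length (rsets (suc k) (suc n)) ≡ length (rsets (suc k) n) + length (rsets k n)
length-rsets-suc k n = begin
  length (filter P? (map (outside ∷_) (subsets n) ++ map (inside ∷_) (subsets n)))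
    ≡⟨ cong length (filter-++ P? (map (outside ∷_) (subsets n)) _) ⟩
  length (filter P? (map (outside ∷_) (subsets n)) ++ filter P? (map (inside ∷_) (subsets n)))
    ≡⟨ length-++ (filter P? (map (outside ∷_) (subsets n))) ⟩
  length (filter P? (map (outside ∷_) (subsets n))) + length (filter P? (map (inside ∷_) (subsets n)))
    ≡⟨ cong₂ _+_ (length-filter-map P? (λ e → ∣ e ∣ ≟ suc k) (outside ∷_) (λ eq → eq) (λ eq → eq) (subsets n))
                 (length-filter-map P? (λ e → ∣ e ∣ ≟ k) (inside ∷_) suc-injective (cong suc) (subsets n)) ⟩
  length (rsets (suc k) n) + length (rsets k n) ∎
  where
  open ≡-Reasoning
  P? = λ (e : Subset (suc n)) → ∣ e ∣ ≟ suc k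

∈-rsets : ∀ {k} {p : Subset n} → ∣ p ∣ ≡ k → p ∈ˡ rsets k n
∈-rsets ∣p∣≡k = ∈-filter⁺ _ (∈-subsets _) ∣p∣≡k

∣∣-rsets : ∀ {k} {p : Subset n} → p ∈ˡ rsets k n → ∣ p ∣ ≡ k
∣∣-rsets {n} {k} = proj₂ ∘ ∈-filter⁻ (λ e → ∣ e ∣ ≟ k) {xs = subsets n}

rsets-unique : ∀ k n → Unique (rsets k n)
rsets-unique k n = Unique.filter⁺ _ (subsets-unique n)

length-rsets-zero : ∀ n → length (rsets 0 n) ≡ 1
length-rsets-zero n = ≤-antisym
  (length-mono {ys = ⊥ ∷ []} (rsets-unique 0 n) λ p∈ → here (empty (∣∣-rsets p∈)))
  (length-mono {xs = ⊥ {n} ∷ []} ([] ∷ []) λ { (here refl) → ∈-rsets (∣⊥∣≡0 n) })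
  where
  empty : ∀ {n} {p : Subset n} → ∣ p ∣ ≡ 0 → p ≡ ⊥
  empty {p = []}          _  = refl
  empty {p = outside ∷ p} eq = cong (outside ∷_) (empty eq)

-- A subtraction-free weakening of (k+1) C(n,k+1) = (n-k) C(n,k), by induction on both arguments
-- through Pascal's rule.
length-rsets-step : ∀ k n → suc k * length (rsets (suc k) n) ≤ n * length (rsets k n)
length-rsets-step k zero = ≤-reflexive (*-zeroʳ k)
length-rsets-step zero (suc n) rewrite length-rsets-suc zero n | length-rsets-zero n | length-rsets-zero (suc n) = begin
  1 * (length (rsets 1 n) + 1)     ≡⟨ *-distribˡ-+ 1 (length (rsets 1 n)) 1 ⟩
  1 * length (rsets 1 n) + 1       ≤⟨ +-monoˡ-≤ 1 (length-rsets-step 0 n) ⟩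
  n * length (rsets 0 n) + 1       ≡⟨ cong (λ z → n * z + 1) (length-rsets-zero n) ⟩
  n * 1 + 1                        ≡⟨ +-comm (n * 1) 1 ⟩
  suc n * 1                        ∎
  where open ≤-Reasoning
length-rsets-step (suc k) (suc n) rewrite length-rsets-suc (suc k) n | length-rsets-suc k n = begin
  suc (suc k) * (a + b)                 ≡⟨ expand₁ k a b ⟩
  suc (suc k) * a + (b + suc k * b)     ≤⟨ +-mono-≤ (length-rsets-step (suc k) n) (+-monoʳ-≤ b (length-rsets-step k n)) ⟩
  n * b + (b + n * c)                   ≤⟨ m≤m+n _ c ⟩
  n * b + (b + n * c) + c               ≡⟨ expand₂ n b c ⟩
  suc n * (b + c)                       ∎
  where
  open ≤-Reasoning
  a = length (rsets (suc (suc k)) n)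
  b = length (rsets (suc k) n)
  c = length (rsets k n)
  expand₁ : ∀ k a b → suc (suc k) * (a + b) ≡ suc (suc k) * a + (b + suc k * b)
  expand₁ = solve-∀
  expand₂ : ∀ n b c → n * b + (b + n * c) + c ≡ suc n * (b + c)
  expand₂ = solve-∀

length-rsets : ∀ k n → length (rsets k n) ≤ n ^ k
length-rsets zero    n = ≤-reflexive (length-rsets-zero n)
length-rsets (suc k) n = begin
  length (rsets (suc k) n)            ≤⟨ m≤n*m _ (suc k) ⟩
  suc k * length (rsets (suc k) n)    ≤⟨ length-rsets-step k n ⟩
  n * length (rsets k n)              ≤⟨ *-monoʳ-≤ n (length-rsets k n) ⟩
  n * n ^ k                           ∎
  where open ≤-Reasoning

-- This keeps the final constant independent of r. The cover of a common link has up to t(r-1)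
-- vertices, and with r = 3 + q the factor r - 1 = 2 + q is absorbed by the number of q-sets. For
-- positive k it holds because 2 + k is at most 3k and k C(n,k) is at most n C(n,k-1).
[2+k]*length-rsets : ∀ k n → (2 + k) * length (rsets k n) ≤ 3 * n ^ k
[2+k]*length-rsets zero    n rewrite length-rsets-zero n = s≤s (s≤s z≤n)
[2+k]*length-rsets (suc k) n = begin
  (3 + k) * a           ≤⟨ m≤m+n _ (2 * k * a) ⟩
  (3 + k) * a + 2 * k * a ≡⟨ expand k a ⟩
  3 * (suc k * a)       ≤⟨ *-monoʳ-≤ 3 (≤-trans (length-rsets-step k n) (*-monoʳ-≤ n (length-rsets k n))) ⟩
  3 * (n * n ^ k)       ∎
  where
  open ≤-Reasoning
  a = length (rsets (suc k) n)
  expand : ∀ k a → (3 + k) * a + 2 * k * a ≡ 3 * (suc k * a)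
  expand = solve-∀

-- Inserting, removing and enumerating elements of subsets.

x∈p─q⇒x∉q : ∀ {x} (p q : Subset n) → x ∈ p ─ q → x ∉ q
x∈p─q⇒x∉q (_ ∷ p) (outside ∷ q) (there x∈) (there x∈q) = x∈p─q⇒x∉q p q x∈ x∈q
x∈p─q⇒x∉q (_ ∷ p) (inside  ∷ q) (there x∈) (there x∈q) = x∈p─q⇒x∉q p q x∈ x∈q

x∉p-x : ∀ {x} {p : Subset n} → x ∉ p - x
x∉p-x {x = x} {p} x∈ = contradiction (x∈⁅x⁆ x) (x∈p─q⇒x∉q p ⁅ x ⁆ x∈)

⁅x⁆∪[p-x] : ∀ {x} {p : Subset n} → x ∈ p → ⁅ x ⁆ ∪ (p - x) ≡ p
⁅x⁆∪[p-x] {x = x} {p} x∈p = ⊆-antisym ⊆₁ ⊆₂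
  where
  ⊆₁ : ⁅ x ⁆ ∪ (p - x) ⊆ p
  ⊆₁ y∈ with x∈p∪q⁻ ⁅ x ⁆ (p - x) y∈
  ... | inj₁ y∈₁ rewrite x∈⁅y⁆⇒x≡y x y∈₁ = x∈p
  ... | inj₂ y∈₂ = p─q⊆p p ⁅ x ⁆ y∈₂

  ⊆₂ : p ⊆ ⁅ x ⁆ ∪ (p - x)
  ⊆₂ {y} y∈ with y Fin.≟ x
  ... | yes refl = x∈p∪q⁺ (inj₁ (x∈⁅x⁆ x))
  ... | no  y≢x  = x∈p∪q⁺ (inj₂ (x∈p∧x≢y⇒x∈p-y y∈ y≢x))

∣p-x∣ : ∀ {x} {p : Subset n} → x ∈ p → suc ∣ p - x ∣ ≡ ∣ p ∣
∣p-x∣ {p = p} x∈p = trans (sym (∣⁅x⁆∪p∣ (x∉p-x {p = p}))) (cong ∣_∣ (⁅x⁆∪[p-x] x∈p))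

⁅x⁆∪p-x : ∀ {x} {p : Subset n} → x ∉ p → (⁅ x ⁆ ∪ p) - x ≡ p
⁅x⁆∪p-x {x = x} {p} x∉p = ⊆-antisym ⊆₁ ⊆₂
  where
  ⊆₁ : (⁅ x ⁆ ∪ p) - x ⊆ p
  ⊆₁ y∈ with x∈p∪q⁻ ⁅ x ⁆ p (p─q⊆p (⁅ x ⁆ ∪ p) ⁅ x ⁆ y∈)
  ... | inj₁ y∈₁ = contradiction y∈₁ (x∈p─q⇒x∉q (⁅ x ⁆ ∪ p) ⁅ x ⁆ y∈)
  ... | inj₂ y∈₂ = y∈₂

  ⊆₂ : p ⊆ (⁅ x ⁆ ∪ p) - x
  ⊆₂ y∈ = x∈p∧x≢y⇒x∈p-y (x∈p∪q⁺ (inj₂ y∈)) λ { refl → x∉p y∈ }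

∪-swap : ∀ (p q r : Subset n) → p ∪ (q ∪ r) ≡ q ∪ (p ∪ r)
∪-swap p q r = trans (sym (∪-assoc p q r)) (trans (cong (_∪ r) (∪-comm p q)) (∪-assoc q p r))

enumerate : ∀ {k} (p : Subset n) → ∣ p ∣ ≡ k →
            ∃[ f ] (Injective {A = Fin k} {B = Fin n} _≡_ _≡_ f × (∀ i → f i ∈ p) × (∀ {x} → x ∈ p → ∃[ i ] f i ≡ x))
enumerate []            refl = (λ ()) , (λ { {()} }) , (λ ()) , λ ()
enumerate (outside ∷ p) refl with f , inj , f∈ , surj ← enumerate p refl =
  suc ∘ f , inj ∘ Fin.suc-injective , there ∘ f∈ , λ { (there x∈) → let i , eq = surj x∈ in i , cong suc eq }
enumerate {n = suc n} (inside  ∷ p) refl with f , inj , f∈ , surj ← enumerate p refl =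
  f⁺ , inj⁺ , f⁺∈ , surj⁺
  where
  f⁺ : Fin (suc ∣ p ∣) → Fin (suc n)
  f⁺ zero    = zero
  f⁺ (suc i) = suc (f i)

  inj⁺ : Injective _≡_ _≡_ f⁺
  inj⁺ {zero}  {zero}  _  = refl
  inj⁺ {suc i} {suc j} eq = cong suc (inj (Fin.suc-injective eq))

  f⁺∈ : ∀ i → f⁺ i ∈ inside ∷ p
  f⁺∈ zero    = here
  f⁺∈ (suc i) = there (f∈ i)

  surj⁺ : ∀ {x} → x ∈ inside ∷ p → ∃[ i ] f⁺ i ≡ x
  surj⁺ here       = zero , refl
  surj⁺ (there x∈) = let i , eq = surj x∈ in suc i , cong suc eq

-- Reciprocal weights scaled to natural numbers.

-- With `N = n !` the quotient is exact for degrees from 1 to n, because d divides d!, which divides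
-- n!. The default 0 at degree 0 lets `weight-*≤` hold for every degree.
weight : ℕ → ℕ → ℕ
weight N zero    = 0
weight N (suc d) = N / suc d

weight-exact : ∀ {d} → 1 ≤ d → d ≤ n → weight (n !) d * d ≡ n !
weight-exact {d = suc d} _ d≤n = m/n*n≡m (∣-trans (m∣m*n (d !)) (m≤n⇒m!∣n! d≤n))

weight-*≤ : ∀ N d → weight N d * d ≤ N
weight-*≤ N zero    = z≤n
weight-*≤ N (suc d) = m/n*n≤m N (suc d)

weight-anti : ∀ N {d e} → 1 ≤ d → d ≤ e → weight N e ≤ weight N d
weight-anti N {suc d} {suc e} _ d≤e = /-monoʳ-≤ N d≤e

-- Building a copy of `K s t (suc k)` from its parts.

-- S lists the images of X, and B those of Y₁, …, Y_t.
module _ {s t k} (F : List (Subset n)) {S : Vec (Fin n) s} (S! : Vec.Unique S) (B : Fin t → Subset n)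
  (∣B∣ : ∀ i → ∣ B i ∣ ≡ k)
  (disjoint : ∀ {i j x} → i ≢ j → x ∈ B i → x ∉ B j)
  (S∉B : ∀ x i → Vec.lookup S x ∉ B i)
  (edge∈F : ∀ x i → ⁅ Vec.lookup S x ⁆ ∪ B i ∈ˡ F) where

  private
    φ : Fin t → Fin k → Fin n
    φ i = proj₁ (enumerate (B i) (∣B∣ i))

    φ-injective : ∀ i → Injective _≡_ _≡_ (φ i)
    φ-injective i = proj₁ (proj₂ (enumerate (B i) (∣B∣ i)))

    φ∈B : ∀ i j → φ i j ∈ B i
    φ∈B i = proj₁ (proj₂ (proj₂ (enumerate (B i) (∣B∣ i))))

    φ-onto : ∀ i {x} → x ∈ B i → ∃[ j ] φ i j ≡ x
    φ-onto i = proj₂ (proj₂ (proj₂ (enumerate (B i) (∣B∣ i))))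

    r = suc k

    embed : Fin (s + t * k) → Fin n
    embed v = [ Vec.lookup S , uncurry φ ∘ remQuot {t} k ]′ (splitAt s v)

    embed-xVertex : ∀ x → embed (xVertex s t r x) ≡ Vec.lookup S x
    embed-xVertex x rewrite Fin.splitAt-↑ˡ s x (t * k) = refl

    embed-yVertex : ∀ i j → embed (yVertex s t r i j) ≡ φ i j
    embed-yVertex i j = trans
      (cong [ Vec.lookup S , uncurry φ ∘ remQuot {t} k ]′ (Fin.splitAt-↑ʳ s (t * k) (combine i j)))
      (cong (uncurry φ) (Fin.remQuot-combine i j))

    vertex-cases : ∀ v → (∃[ x ] xVertex s t r x ≡ v) ⊎ (∃[ i ] ∃[ j ] yVertex s t r i j ≡ v)
    vertex-cases v with splitAt s v in eq
    ... | inj₁ x = inj₁ (x , Fin.splitAt⁻¹-↑ˡ eq)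
    ... | inj₂ m = inj₂ (proj₁ (remQuot {t} k m) , proj₂ (remQuot {t} k m) ,
      trans (cong (s ↑ʳ_) (Fin.combine-remQuot {t} k m)) (Fin.splitAt⁻¹-↑ʳ eq))

    embed-injective : Injective _≡_ _≡_ embed
    embed-injective {u} {v} eq with vertex-cases u | vertex-cases v
    ... | inj₁ (x , refl) | inj₁ (y , refl) = cong (xVertex s t r)
      (VecUnique.lookup-injective S! x y (trans (sym (embed-xVertex x)) (trans eq (embed-xVertex y))))
    ... | inj₁ (x , refl) | inj₂ (i , j , refl) = contradiction
      (subst (_∈ B i) (trans (sym (embed-yVertex i j)) (trans (sym eq) (embed-xVertex x))) (φ∈B i j)) (S∉B x i)
    ... | inj₂ (i , j , refl) | inj₁ (x , refl) = contradiction
      (subst (_∈ B i) (trans (sym (embed-yVertex i j)) (trans eq (embed-xVertex x))) (φ∈B i j)) (S∉B x i)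
    ... | inj₂ (i , j , refl) | inj₂ (i′ , j′ , refl) with i Fin.≟ i′
    ... | yes refl = cong (yVertex s t r i) (φ-injective i (trans (sym (embed-yVertex i j)) (trans eq (embed-yVertex i j′))))
    ... | no i≢i′  = contradiction
      (subst (_∈ B i′) (trans (sym (embed-yVertex i′ j′)) (trans (sym eq) (embed-yVertex i j))) (φ∈B i′ j′))
      (disjoint i≢i′ (φ∈B i j))

    image-edge : ∀ x i → image embed (edge s t r x i) ≡ ⁅ Vec.lookup S x ⁆ ∪ B i
    image-edge x i = ⊆-antisym ⊆₁ ⊆₂
      where
      ⊆₁ : image embed (edge s t r x i) ⊆ ⁅ Vec.lookup S x ⁆ ∪ B i
      ⊆₁ {y} y∈ with v , v∈ , refl ← ∈-image⁻ embed (edge s t r x i) y∈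
        with x∈p∪q⁻ ⁅ xVertex s t r x ⁆ (Y s t r i) v∈
      ... | inj₁ v∈₁ = x∈p∪q⁺ (inj₁ (subst (_∈ ⁅ Vec.lookup S x ⁆)
        (trans (sym (embed-xVertex x)) (cong embed (sym (x∈⁅y⁆⇒x≡y _ v∈₁)))) (x∈⁅x⁆ _)))
      ... | inj₂ v∈₂ = let j , _ , eq = ∈-image⁻ (yVertex s t r i) ⊤ v∈₂ in
        x∈p∪q⁺ (inj₂ (subst (_∈ B i) (trans (sym (embed-yVertex i j)) (cong embed eq)) (φ∈B i j)))

      ⊆₂ : ⁅ Vec.lookup S x ⁆ ∪ B i ⊆ image embed (edge s t r x i)
      ⊆₂ {y} y∈ with x∈p∪q⁻ ⁅ Vec.lookup S x ⁆ (B i) y∈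
      ... | inj₁ y∈₁ = subst (_∈ image embed (edge s t r x i))
        (trans (embed-xVertex x) (sym (x∈⁅y⁆⇒x≡y _ y∈₁)))
        (∈-image⁺ embed (x∈p∪q⁺ (inj₁ (x∈⁅x⁆ (xVertex s t r x)))))
      ... | inj₂ y∈₂ = let j , eq = φ-onto i y∈₂ in subst (_∈ image embed (edge s t r x i))
        (trans (embed-yVertex i j) eq)
        (∈-image⁺ embed (x∈p∪q⁺ {p = ⁅ xVertex s t r x ⁆} (inj₂ (∈-image⁺ (yVertex s t r i) (∈⊤ {x = j})))))

  -- The map `embed` sends X to the entries of `S` and the block `Y i` onto `B i` through an
  -- enumeration of `B i`. Injectivity splits into cases: distinct entries of `S`, `S` against the
  -- blocks, two different blocks, and a single block.
  K⊑ : edges (K s t (suc k)) ⊑ F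
  K⊑ = embed , embed-injective , All.deduplicate⁺ _≟ˢ_ (All.tabulate λ e∈ →
    let x , i , _ , _ , eq = ∈-cartesianProductWith⁻ (edge s t r) (allFin s) (allFin t) e∈
    in subst (_∈ˡ F) (sym (trans (cong (image embed) eq) (image-edge x i))) (edge∈F x i))

-- Maximal matchings and covers of common links.

Disjoint : Subset n → Subset n → Set
Disjoint p q = ¬ Nonempty (p ∩ q)

-- A set is added exactly when it meets none of those already chosen, so the result is a maximal
-- matching. Nonemptiness ensures that an added set meets a member of the matching, namely itself.
greedy-matching : ∀ (L : List (Subset n)) → (∀ {p} → p ∈ˡ L → Nonempty p) →
  ∃[ M ] ((∀ {p} → p ∈ˡ M → p ∈ˡ L) × AllPairs Disjoint M × (∀ {p} → p ∈ˡ L → Any (λ q → Nonempty (p ∩ q)) M))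
greedy-matching []      _        = [] , (λ ()) , [] , λ ()
greedy-matching (p ∷ L) nonempty with M , M⊆L , disj , maximal ← greedy-matching L (nonempty ∘ there)
  with any? (λ q → nonempty? (p ∩ q)) M
... | yes p∩M = M , there ∘ M⊆L , disj , λ { (here refl) → p∩M ; (there q∈) → maximal q∈ }
... | no ¬p∩M = p ∷ M , (λ { (here refl) → here refl ; (there q∈) → there (M⊆L q∈) })
  , All.¬Any⇒All¬ M ¬p∩M ∷ disj
  , λ { (here refl) → let x , x∈p = nonempty (here refl) in here (x , x∈p∩q⁺ (x∈p , x∈p))
      ; (there q∈) → there (maximal q∈) }

AllPairs-lookup : ∀ {R : A → A → Set} {xs} → Symmetric R → AllPairs R xs →
                  ∀ {i j} → i ≢ j → R (lookup xs i) (lookup xs j)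
AllPairs-lookup R-sym (_ ∷ _)  {zero}  {zero}  i≢j = contradiction refl i≢j
AllPairs-lookup {xs = _ ∷ xs} R-sym (r ∷ _)  {zero}  {suc j} _   = All.lookup r (∈-lookup {xs = xs} j)
AllPairs-lookup {xs = _ ∷ xs} R-sym (r ∷ _)  {suc i} {zero}  _   = R-sym (All.lookup r (∈-lookup {xs = xs} i))
AllPairs-lookup R-sym (_ ∷ rs) {suc i} {suc j} i≢j = AllPairs-lookup R-sym rs (i≢j ∘ cong suc)

Disjoint-sym : Symmetric (Disjoint {n})
Disjoint-sym {x = p} {q} p∩q≡∅ = p∩q≡∅ ∘ subst Nonempty (∩-comm q p)

elements-union : ∀ {k} (M : List (Subset n)) → (∀ {p} → p ∈ˡ M → ∣ p ∣ ≡ k) →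
                 ∃[ T ] (length T ≡ length M * k × (∀ {p x} → p ∈ˡ M → x ∈ p → x ∈ˡ T))
elements-union []      _   = [] , refl , λ ()
elements-union {k = k} (p ∷ M) ∣p∣≡k
  with T , ∣T∣ , ⊆T ← elements-union M (∣p∣≡k ∘ there) | f , _ , _ , onto ← enumerate p (∣p∣≡k (here refl)) =
  map f (allFin k) ++ T
  , trans (length-++ (map f (allFin k))) (cong₂ _+_ (trans (length-map f (allFin k)) (length-tabulate {n = k} (λ i → i))) ∣T∣)
  , λ { (here refl) x∈p → let i , fi≡x = onto x∈p
                          in ∈-++⁺ˡ (subst (_∈ˡ map f (allFin k)) fi≡x (∈-map⁺ f (∈-allFin i)))
      ; (there q∈)  x∈q → ∈-++⁺ʳ (map f (allFin k)) (⊆T q∈ x∈q) }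

∣p∣≡suc⇒Nonempty : ∀ {k} {p : Subset n} → ∣ p ∣ ≡ suc k → Nonempty p
∣p∣≡suc⇒Nonempty {p = p} ∣p∣≡ = let f , _ , f∈ , _ = enumerate p ∣p∣≡ in f zero , f∈ zero

-- Take a maximal matching in `L`. If it had `t` members, they would serve as the blocks and `S` as
-- X, giving a forbidden copy. Otherwise the union of its members is small, and by maximality it
-- meets every set in `L`.
link-cover : ∀ {s t k} (F : List (Subset n)) → ¬ (edges (K s t (2 + k)) ⊑ F) →
  {S : Vec (Fin n) s} → Vec.Unique S → (L : List (Subset n)) →
  (∀ {p} → p ∈ˡ L → ∣ p ∣ ≡ suc k) →
  (∀ {p} → p ∈ˡ L → ∀ x → Vec.lookup S x ∉ p × ⁅ Vec.lookup S x ⁆ ∪ p ∈ˡ F) →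
  ∃[ T ] (length T ≤ t * suc k × (∀ {p} → p ∈ˡ L → ∃[ y ] (y ∈ˡ T × y ∈ p)))
link-cover {t = t} {k} F K-free S! L ∣p∣≡k link
  with M , M⊆L , disj , maximal ← greedy-matching L (∣p∣≡suc⇒Nonempty ∘ ∣p∣≡k)
  with T , ∣T∣ , ⊆T ← elements-union M (∣p∣≡k ∘ M⊆L) | t ≤? length M
... | no t≰∣M∣ = T , ≤-trans (≤-reflexive ∣T∣) (*-monoˡ-≤ (suc k) (≰⇒≥ t≰∣M∣)) , λ p∈ →
  let q , q∈M , y , y∈ = find (maximal p∈)
      y∈p , y∈q = x∈p∩q⁻ _ _ y∈
  in y , ⊆T q∈M y∈q , y∈p
... | yes t≤∣M∣ = contradiction
  (K⊑ F S! part (λ i → ∣p∣≡k (part∈L i)) 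
    (λ i≢j x∈ x∈′ → AllPairs-lookup Disjoint-sym disj (i≢j ∘ Fin.inject≤-injective _ _ _ _) (_ , x∈p∩q⁺ (x∈ , x∈′)))
    (λ x i → proj₁ (link (part∈L i) x)) (λ x i → proj₂ (link (part∈L i) x)))
  K-free
  where
  -- The first `t` members of the matching become the blocks.
  part : Fin t → Subset _
  part i = lookup M (inject≤ i t≤∣M∣)

  part∈L : ∀ i → part i ∈ˡ L
  part∈L i = M⊆L (∈-lookup {xs = M} (inject≤ i t≤∣M∣))

-- Tuples with a prescribed last entry, and maxima over a set.

length-cartesianProductWith : ∀ (h : A → B → C) as bs → length (cartesianProductWith h as bs) ≡ length as * length bs
length-cartesianProductWith h []       bs = refl
length-cartesianProductWith h (a ∷ as) bs = trans (length-++ (map (h a) bs))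
  (cong₂ _+_ (length-map (h a) bs) (length-cartesianProductWith h as bs))

length-allFin : ∀ n → length (allFin n) ≡ n
length-allFin n = length-tabulate {n = n} id

-- Entries are added at the front, so `x` stays last. Repetitions are allowed, which makes the count
-- exactly `n ^ k`; `sel?` later gives tuples with repetitions the value 0.
extensions : ∀ k → Fin n → List (Vec (Fin n) (suc k))
extensions zero    x = (x ∷ []) ∷ []
extensions (suc k) x = cartesianProductWith (λ S y → y ∷ S) (extensions k x) (allFin _)

length-extensions : ∀ k (x : Fin n) → length (extensions k x) ≡ n ^ k
length-extensions         zero    x = refl
length-extensions {n = n} (suc k) x = trans (length-cartesianProductWith _ (extensions k x) (allFin n))
  (trans (cong₂ _*_ (length-extensions k x) (length-allFin n)) (*-comm (n ^ k) n))

∃-maximum : ∀ {k} (g : Fin n → ℕ) (p : Subset n) → ∣ p ∣ ≡ suc k →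
            ∃[ x ] (x ∈ p × (∀ {z} → z ∈ p → g z ≤ g x))
∃-maximum g p ∣p∣≡ with φ , _ , φ∈ , onto ← enumerate p ∣p∣≡ =
  φ i , φ∈ i , λ z∈p → let j , φj≡z = onto z∈p in
    subst (λ z → g z ≤ g (φ i)) φj≡z (All.lookup (f[xs]≤f[argmax] {f = g ∘ φ} zero (allFin _)) (∈-allFin j))
  where
  i = argmax (g ∘ φ) zero (allFin _)

-- Degrees, tops and the weight of a common link.

module Counting {n} (F : List (Subset n)) where

  Nb : Fin n → Subset n → Set
  Nb x p = x ∉ p × ⁅ x ⁆ ∪ p ∈ˡ F

  nb? : ∀ x p → Dec (Nb x p)
  nb? x p = ¬? (x ∈? p) ×-dec member? _≟ˢ_ (⁅ x ⁆ ∪ p) F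

  deg : Subset n → ℕ
  deg p = ∑ (allFin n) (λ x → ⟦ nb? x p ⟧)

  deg≤n : ∀ p → deg p ≤ n
  deg≤n p = ≤-trans (∑-≤-const {xs = allFin n} {c = 1} λ {x} _ → ⟦⟧≤1 (nb? x p)) (≤-reflexive (trans (*-identityʳ _) (length-allFin n)))

  deg>0 : ∀ {x p} → Nb x p → 0 < deg p
  deg>0 {x} {p} nb = ≤-trans (⟦⟧-true (nb? x p) nb)
    (≤-trans (m≤m+n _ _) (≤-reflexive (sym (∑-remove (∈-allFin x) _))))

  -- The sets `(⁅ x ⁆ ∪ p) - z` run over all facets of the edge; `z = x` gives `p` itself.
  Top : Fin n → Subset n → Set
  Top x p = Nb x p × (∀ z → z ∈ ⁅ x ⁆ ∪ p → deg ((⁅ x ⁆ ∪ p) - z) ≤ deg p)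

  top? : ∀ x p → Dec (Top x p)
  top? x p = nb? x p ×-dec Fin.all? λ z → (z ∈? (⁅ x ⁆ ∪ p)) →-dec (deg ((⁅ x ⁆ ∪ p) - z) ≤? deg p)

  tops : Subset n → ℕ
  tops p = ∑ (allFin n) (λ x → ⟦ top? x p ⟧)

  tops≤deg : ∀ p → tops p ≤ deg p
  tops≤deg p = ∑-mono {xs = allFin n} λ {x} _ → ⟦⟧-mono (top? x p) (nb? x p) proj₁

  -- In an edge `e` choose `x` maximising `deg (e - x)`; then `x` is a top of `e - x`. The pair
  -- determines `e` as the union, so distinct edges are charged to distinct pairs.
  edges≤tops : ∀ {k} → Unique F → (∀ {e} → e ∈ˡ F → ∣ e ∣ ≡ suc k) → length F ≤ ∑ (rsets k n) tops
  edges≤tops {k} F! ∣e∣≡ = begin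
    length F                 ≡⟨ *-identityʳ _ ⟨
    length F * 1             ≡⟨ ∑-const F 1 ⟨
    ∑ F (λ _ → 1)            ≤⟨ ∑-cover (λ (p , x) → ⁅ x ⁆ ∪ p) F! (λ e∈ _ → top-part e∈) ⟩
    ∑ (cartesianProduct (rsets k n) (allFin n)) (λ (p , x) → ⟦ top? x p ⟧)
                             ≡⟨ ∑-cartesianProductWith _,_ (rsets k n) (allFin n) _ ⟩
    ∑ (rsets k n) tops       ∎
    where
    open ≤-Reasoning
    top-part : ∀ {e} → e ∈ˡ F → ∃[ k′ ] (k′ ∈ˡ cartesianProduct (rsets k n) (allFin n) ×
               ⁅ proj₂ k′ ⁆ ∪ proj₁ k′ ≡ e × 1 ≤ ⟦ top? (proj₂ k′) (proj₁ k′) ⟧)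
    top-part {e} e∈ =
      let x , x∈ , maximal = ∃-maximum (λ y → deg (e - y)) e (∣e∣≡ e∈)
          e≡ = ⁅x⁆∪[p-x] x∈
      in (e - x , x)
       , ∈-cartesianProduct⁺ (∈-rsets (suc-injective (trans (∣p-x∣ x∈) (∣e∣≡ e∈)))) (∈-allFin x)
       , e≡
       , ⟦⟧-true (top? x (e - x)) ((x∉p-x {p = e} , subst (_∈ˡ F) (sym e≡) e∈) ,
           subst (λ p → ∀ z → z ∈ p → deg (p - z) ≤ deg (e - x)) (sym e≡) (λ _ → maximal))

  Sel : ∀ {s} → Vec (Fin n) s → Subset n → Set
  Sel S p = Vec.Unique S × VecAll.All (λ x → Nb x p) S

  sel? : ∀ {s} (S : Vec (Fin n) s) p → Dec (Sel S p)
  sel? S p = VecPairs.allPairs? (λ x y → ¬? (x Fin.≟ y)) S ×-dec VecAll.all? (λ x → nb? x p) S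

  -- Every neighbour of `p` either is one of the `m` entries of `S` or can be put in front of `S`.
  deg∸m≤sel : ∀ {m} {S : Vec (Fin n) m} {p} → Sel S p → deg p ∸ m ≤ ∑ (allFin n) (λ y → ⟦ sel? (y ∷ S) p ⟧)
  deg∸m≤sel {m} {S} {p} (S! , nbs) = m≤n+o⇒m∸n≤o (deg p) m (begin
    deg p                              ≤⟨ ∑-mono {xs = allFin n} (λ {y} _ → split y) ⟩
    ∑ (allFin n) (λ y → ⟦ y ∈S? ⟧ + ⟦ sel? (y ∷ S) p ⟧) ≡⟨ ∑-distrib-+ (allFin n) _ _ ⟩
    ∑ (allFin n) (λ y → ⟦ y ∈S? ⟧) + R  ≤⟨ +-monoˡ-≤ R S-small ⟩
    m + R                              ∎)
    where
    open ≤-Reasoning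
    R = ∑ (allFin n) (λ y → ⟦ sel? (y ∷ S) p ⟧)

    _∈S? : ∀ y → Dec (y ∈ᵛ S)
    y ∈S? = memberᵛ? Fin._≟_ y S

    split : ∀ y → ⟦ nb? y p ⟧ ≤ ⟦ y ∈S? ⟧ + ⟦ sel? (y ∷ S) p ⟧
    split y with y ∈S?
    ... | yes _  = ≤-trans (⟦⟧≤1 (nb? y p)) (m≤m+n 1 _)
    ... | no y∉S = ⟦⟧-mono (nb? y p) (sel? (y ∷ S) p) λ nb →
      (VecAll.lookup⁻ (λ i y≡ → y∉S (subst (_∈ᵛ S) (sym y≡) (∈ᵛ-lookup i S))) ∷ S!) , nb ∷ nbs

    S-small : ∑ (allFin n) (λ y → ⟦ y ∈S? ⟧) ≤ m
    S-small = begin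
      ∑ (allFin n) (λ y → ⟦ y ∈S? ⟧) ≤⟨ ∑-cover id (Unique.allFin⁺ n) (λ {y} _ y∈ →
                                        y , ∈-toList⁺ (⟦⟧>0⇒ (y ∈S?) y∈) , refl , ⟦⟧≤1 (y ∈S?)) ⟩
      ∑ (toList S) (λ _ → 1)         ≡⟨ ∑-const (toList S) 1 ⟩
      length (toList S) * 1          ≡⟨ trans (*-identityʳ _) (length-toList S) ⟩
      m                              ∎

  -- The tuple is grown one neighbour at a time. A selected tuple of length `suc j` has at least
  -- `deg p ∸ suc j` continuations, and `j < k` replaces this by the uniform factor `deg p ∸ k`.
  extensions-sel : ∀ {x p} k → Nb x p → ∀ j → j ≤ k →
                   (deg p ∸ k) ^ j ≤ ∑ (extensions j x) (λ S → ⟦ sel? S p ⟧)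
  extensions-sel {x} {p} k nb zero    _   = ≤-trans (⟦⟧-true (sel? (x ∷ []) p) (([] ∷ []) , nb ∷ [])) (m≤m+n _ 0)
  extensions-sel {x} {p} k nb (suc j) j<k = begin
    d * d ^ j                                            ≤⟨ *-monoʳ-≤ d (extensions-sel k nb j (<⇒≤ j<k)) ⟩
    d * ∑ (extensions j x) (λ S → ⟦ sel? S p ⟧)          ≡⟨ ∑-distribˡ-* d (extensions j x) _ ⟨
    ∑ (extensions j x) (λ S → d * ⟦ sel? S p ⟧)          ≤⟨ ∑-mono {xs = extensions j x} (λ {S} _ → extend S) ⟩
    ∑ (extensions j x) (λ S → ∑ (allFin n) λ y → ⟦ sel? (y ∷ S) p ⟧) ≡⟨ ∑-cartesianProductWith _ (extensions j x) (allFin n) _ ⟨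
    ∑ (extensions (suc j) x) (λ S → ⟦ sel? S p ⟧)        ∎
    where
    open ≤-Reasoning
    d = deg p ∸ k

    extend : ∀ S → d * ⟦ sel? S p ⟧ ≤ ∑ (allFin n) (λ y → ⟦ sel? (y ∷ S) p ⟧)
    extend S with sel? S p
    ... | no  _   = ≤-trans (≤-reflexive (*-zeroʳ d)) z≤n
    ... | yes sel = ≤-trans (≤-reflexive (*-identityʳ d)) (≤-trans (∸-monoʳ-≤ (deg p) j<k) (deg∸m≤sel sel))

  -- If y lies in the cover of the common link of S, write p = ⁅ z ⁆ ∪ V with
  -- V = ⁅ y ⁆ ∪ W; since x is a top of p, each V contributes at most
  -- deg (⁅ x ⁆ ∪ V) terms of weight at most N / deg (⁅ x ⁆ ∪ V).
  common-link-weight : ∀ {s t q} N x (S : Vec (Fin n) s) → ¬ (edges (K s t (3 + q)) ⊑ F) →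
    ∑ (rsets (2 + q) n) (λ p → ⟦ top? x p ⟧ * (⟦ sel? S p ⟧ * weight N (deg p))) ≤ t * (2 + q) * length (rsets q n) * N
  common-link-weight {s} {t} {q} N x S K-free = case VecPairs.allPairs? (λ x y → ¬? (x Fin.≟ y)) S of λ where
      (yes S!) → distinct S!
      -- A tuple with a repeated entry is selected by no `p`, so every term vanishes.
      (no ¬S!) → ≤-trans
        (∑-≤-const {xs = rsets (2 + q) n} {c = 0} λ {p} _ → ≤-reflexive
          (trans (cong (λ z → ⟦ top? x p ⟧ * (z * weight N (deg p))) (⟦⟧-false (sel? S p) (¬S! ∘ proj₁))) (*-zeroʳ ⟦ top? x p ⟧)))
        (≤-trans (≤-reflexive (*-zeroʳ (length (rsets (2 + q) n)))) z≤n)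
    where
    open ≤-Reasoning

    term : Subset n → ℕ
    term p = ⟦ top? x p ⟧ * (⟦ sel? S p ⟧ * weight N (deg p))

    part : Fin n → Subset n → ℕ
    part z V = ⟦ nb? z (⁅ x ⁆ ∪ V) ⟧ * weight N (deg (⁅ x ⁆ ∪ V))

    term≤weight : ∀ p → term p ≤ weight N (deg p)
    term≤weight p = begin
      ⟦ top? x p ⟧ * (⟦ sel? S p ⟧ * weight N (deg p))  ≤⟨ *-mono-≤ (⟦⟧≤1 (top? x p)) (*-monoˡ-≤ _ (⟦⟧≤1 (sel? S p))) ⟩
      1 * (1 * weight N (deg p))                        ≡⟨ trans (*-identityˡ _) (*-identityˡ _) ⟩
      weight N (deg p)                                  ∎

    term≤part : ∀ {z V} → z ∉ V → Top x (⁅ z ⁆ ∪ V) → term (⁅ z ⁆ ∪ V) ≤ part z V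
    term≤part {z} {V} z∉V ((x∉p , e∈) , maximal) = begin
      term (⁅ z ⁆ ∪ V)                     ≤⟨ term≤weight (⁅ z ⁆ ∪ V) ⟩
      -- Antitonicity needs the smaller degree to be positive, as `weight N 0` is 0; here `z` is a
      -- neighbour of `⁅ x ⁆ ∪ V`.
      weight N (deg (⁅ z ⁆ ∪ V))           ≤⟨ weight-anti N (deg>0 nb) (subst (λ p → deg p ≤ deg (⁅ z ⁆ ∪ V)) e-z
                                               (maximal z (subst (z ∈_) (sym e≡) (x∈p∪q⁺ (inj₁ (x∈⁅x⁆ z)))))) ⟩
      weight N (deg (⁅ x ⁆ ∪ V))           ≡⟨ *-identityˡ _ ⟨
      1 * weight N (deg (⁅ x ⁆ ∪ V))       ≤⟨ *-monoˡ-≤ _ (⟦⟧-true (nb? z (⁅ x ⁆ ∪ V)) nb) ⟩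
      part z V                             ∎
      where
      e≡ : ⁅ x ⁆ ∪ (⁅ z ⁆ ∪ V) ≡ ⁅ z ⁆ ∪ (⁅ x ⁆ ∪ V)
      e≡ = ∪-swap ⁅ x ⁆ ⁅ z ⁆ V

      z∉ : z ∉ ⁅ x ⁆ ∪ V
      z∉ z∈ with x∈p∪q⁻ ⁅ x ⁆ V z∈
      ... | inj₁ z∈₁ = x∉p (x∈p∪q⁺ (inj₁ (subst (_∈ ⁅ z ⁆) (x∈⁅y⁆⇒x≡y x z∈₁) (x∈⁅x⁆ z))))
      ... | inj₂ z∈₂ = z∉V z∈₂

      nb : Nb z (⁅ x ⁆ ∪ V)
      nb = z∉ , subst (_∈ˡ F) e≡ e∈

      e-z : (⁅ x ⁆ ∪ (⁅ z ⁆ ∪ V)) - z ≡ ⁅ x ⁆ ∪ V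
      e-z = trans (cong (_- z) e≡) (⁅x⁆∪p-x z∉)

    -- The brackets add up to `deg (⁅ x ⁆ ∪ V)`, which cancels the denominator of the weight.
    parts≤N : ∀ V → ∑ (allFin n) (λ z → part z V) ≤ N
    parts≤N V = begin
      ∑ (allFin n) (λ z → part z V)   ≡⟨ ∑-cong {xs = allFin n} (λ z → *-comm ⟦ nb? z (⁅ x ⁆ ∪ V) ⟧ _) ⟩
      ∑ (allFin n) (λ z → weight N (deg (⁅ x ⁆ ∪ V)) * ⟦ nb? z (⁅ x ⁆ ∪ V) ⟧)
                                      ≡⟨ ∑-distribˡ-* (weight N (deg (⁅ x ⁆ ∪ V))) (allFin n) _ ⟩
      weight N (deg (⁅ x ⁆ ∪ V)) * deg (⁅ x ⁆ ∪ V) ≤⟨ weight-*≤ N (deg (⁅ x ⁆ ∪ V)) ⟩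
      N                               ∎

    module Cover (T : List (Fin n)) (∣T∣≤ : length T ≤ t * (2 + q))
      (T-covers : ∀ {p} → p ∈ˡ filter (sel? S) (rsets (2 + q) n) → ∃[ y ] (y ∈ˡ T × y ∈ p)) where

      TW : List (Fin n × Subset n)
      TW = cartesianProduct T (rsets q n)

      set : (Fin n × Subset n) × Fin n → Subset n
      set ((y , W) , z) = ⁅ z ⁆ ∪ (⁅ y ⁆ ∪ W)

      bound : (Fin n × Subset n) × Fin n → ℕ
      bound ((y , W) , z) = part z (⁅ y ⁆ ∪ W)

      cover-element : ∀ {p y z} → p ∈ˡ rsets (2 + q) n → Top x p → y ∈ˡ T → y ∈ p → z ∈ p - y →
                 ∃[ k ] (k ∈ˡ cartesianProduct TW (allFin n) × set k ≡ p × term p ≤ bound k)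
      cover-element {p} {y} {z} p∈ top y∈T y∈p z∈ =
        ((y , W) , z)
        , ∈-cartesianProduct⁺ (∈-cartesianProduct⁺ y∈T (∈-rsets ∣W∣)) (∈-allFin z)
        , p≡ , subst (λ p → term p ≤ part z (⁅ y ⁆ ∪ W)) p≡ (term≤part z∉V (subst (Top x) (sym p≡) top))
        where
        W = (p - y) - z

        ∣W∣ : ∣ W ∣ ≡ q
        ∣W∣ = suc-injective (trans (∣p-x∣ z∈) (suc-injective (trans (∣p-x∣ y∈p) (∣∣-rsets p∈))))

        p≡ : ⁅ z ⁆ ∪ (⁅ y ⁆ ∪ W) ≡ p
        p≡ = trans (∪-swap ⁅ z ⁆ ⁅ y ⁆ W) (trans (cong (⁅ y ⁆ ∪_) (⁅x⁆∪[p-x] z∈)) (⁅x⁆∪[p-x] y∈p))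

        z∉V : z ∉ ⁅ y ⁆ ∪ W
        z∉V z∈V with x∈p∪q⁻ ⁅ y ⁆ W z∈V
        ... | inj₁ z∈₁ = x∈p─q⇒x∉q p ⁅ y ⁆ z∈ z∈₁
        ... | inj₂ z∈₂ = x∉p-x {p = p - y} z∈₂

      covered : ∀ {p} → p ∈ˡ rsets (2 + q) n → 0 < term p →
                ∃[ k ] (k ∈ˡ cartesianProduct TW (allFin n) × set k ≡ p × term p ≤ bound k)
      covered {p} p∈ 0<term =
        let top , sel = ⟦⟧*⟦⟧*>0⇒ (top? x p) (sel? S p) 0<term
            y , y∈T , y∈p = T-covers (∈-filter⁺ (sel? S) p∈ sel)
            -- A second element exists because `p` has `2 + q` elements; this is where uniformity at
            -- least 3 enters.
            z , z∈ = ∣p∣≡suc⇒Nonempty (suc-injective (trans (∣p-x∣ y∈p) (∣∣-rsets p∈)))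
        in cover-element p∈ top y∈T y∈p z∈

      ∑-term≤ : ∑ (rsets (2 + q) n) term ≤ t * (2 + q) * length (rsets q n) * N
      ∑-term≤ = begin
        ∑ (rsets (2 + q) n) term                 ≤⟨ ∑-cover set (rsets-unique (2 + q) n) covered ⟩
        ∑ (cartesianProduct TW (allFin n)) bound ≡⟨ ∑-cartesianProductWith _,_ TW (allFin n) bound ⟩
        ∑ TW (λ (y , W) → ∑ (allFin n) (λ z → part z (⁅ y ⁆ ∪ W)))
                                                 ≤⟨ ∑-≤-const {xs = TW} (λ {(y , W)} _ → parts≤N (⁅ y ⁆ ∪ W)) ⟩
        length TW * N                            ≡⟨ cong (_* N) (length-cartesianProductWith _,_ T (rsets q n)) ⟩
        length T * length (rsets q n) * N        ≤⟨ *-monoˡ-≤ N (*-monoˡ-≤ (length (rsets q n)) ∣T∣≤) ⟩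
        t * (2 + q) * length (rsets q n) * N     ∎

    distinct : Vec.Unique S → ∑ (rsets (2 + q) n) term ≤ t * (2 + q) * length (rsets q n) * N
    distinct S! =
      let T , ∣T∣≤ , T-covers = link-cover F K-free S! (filter (sel? S) (rsets (2 + q) n))
            (∣∣-rsets ∘ proj₁ ∘ ∈-filter⁻ (sel? S) {xs = rsets (2 + q) n})
            (λ p∈ i → VecAll.lookup⁺ (proj₂ (proj₂ (∈-filter⁻ (sel? S) {xs = rsets (2 + q) n} p∈))) i)
      in Cover.∑-term≤ T ∣T∣≤ T-covers

-- From total weight to the bound on the number of edges.

^-distribʳ-* : ∀ a b k → (a * b) ^ k ≡ a ^ k * b ^ k
^-distribʳ-* a b zero    = refl
^-distribʳ-* a b (suc k) rewrite ^-distribʳ-* a b k = interchange a b (a ^ k) (b ^ k)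
  where
  interchange : ∀ a b c d → a * b * (c * d) ≡ a * c * (b * d)
  interchange = solve-∀

-- Here `c` stands for `tops p` and `d` for `deg p`. If d exceeds j+1, then d is at most
-- (2+j)(d-j-1), and c^(j+1) is at most c d^j = c d^(j+1)/d. For smaller d, `c` is at most j+1 and
-- the summand `n !` alone suffices.
weighted-power : ∀ j {c d n} → c ≤ d → d ≤ n →
  n ! * c ^ suc j ≤ (2 + j) ^ suc j * (n ! + c * ((d ∸ suc j) ^ suc j * weight (n !) d))
weighted-power j {c} {d} {n} c≤d d≤n with suc j <? d
... | no  j≮d = begin
  n ! * c ^ suc j                  ≤⟨ *-monoʳ-≤ (n !) (^-monoˡ-≤ (suc j) (≤-trans c≤d (≤-trans (≮⇒≥ j≮d) (n≤1+n _)))) ⟩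
  n ! * (2 + j) ^ suc j            ≡⟨ *-comm (n !) _ ⟩
  (2 + j) ^ suc j * n !            ≤⟨ *-monoʳ-≤ ((2 + j) ^ suc j) (m≤m+n (n !) _) ⟩
  (2 + j) ^ suc j * (n ! + _)      ∎
  where open ≤-Reasoning
... | yes j<d = begin
  n ! * (c * c ^ j)                        ≤⟨ *-monoʳ-≤ (n !) (*-monoʳ-≤ c (^-monoˡ-≤ j c≤d)) ⟩
  n ! * (c * d ^ j)                        ≡⟨ cong (_* (c * d ^ j)) (weight-exact (≤-trans (s≤s z≤n) j<d) d≤n) ⟨
  w * d * (c * d ^ j)                      ≡⟨ regroup w d c (d ^ j) ⟩
  w * c * (d * d ^ j)                      ≤⟨ *-monoʳ-≤ (w * c) (^-monoˡ-≤ (suc j) d≤) ⟩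
  w * c * ((2 + j) * (d ∸ suc j)) ^ suc j  ≡⟨ cong (w * c *_) (^-distribʳ-* (2 + j) (d ∸ suc j) (suc j)) ⟩
  w * c * ((2 + j) ^ suc j * p)            ≡⟨ regroup′ w c ((2 + j) ^ suc j) p ⟩
  (2 + j) ^ suc j * (c * (p * w))          ≤⟨ *-monoʳ-≤ ((2 + j) ^ suc j) (m≤n+m _ (n !)) ⟩
  (2 + j) ^ suc j * (n ! + c * (p * w))    ∎
  where
  open ≤-Reasoning
  w = weight (n !) d
  p = (d ∸ suc j) ^ suc j

  regroup : ∀ w d c e → w * d * (c * e) ≡ w * c * (d * e)
  regroup = solve-∀

  regroup′ : ∀ w c a p → w * c * (a * p) ≡ a * (c * (p * w))
  regroup′ = solve-∀

  d≤ : d ≤ (2 + j) * (d ∸ suc j)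
  d≤ with m , refl ← m≤n⇒∃[o]m+o≡n j<d = begin
    2 + j + m                         ≤⟨ m≤m+n _ (suc j * m) ⟩
    2 + j + m + suc j * m             ≡⟨ expand j m ⟩
    (2 + j) * suc m                   ≡⟨ cong ((2 + j) *_) (trans (cong (_∸ suc j) (sym (+-suc (suc j) m))) (m+n∸m≡n (suc j) (suc m))) ⟨
    (2 + j) * (2 + j + m ∸ suc j)     ∎
    where
    expand : ∀ j m → 2 + j + m + suc j * m ≡ (2 + j) * suc m
    expand = solve-∀

module _ {n} (F : List (Subset n)) where
  open Counting F

  -- Double counting of triples (p, x, S) with `x` a top of `p` and `S` a selected tuple ending in
  -- `x`. For fixed `p` and `x`, `extensions-sel` bounds the number of `S` from below; after
  -- swapping sums, `common-link-weight` applies to each of the n · n^k pairs (x, S).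
  ∑-weights-upper : ∀ {t q} k → ¬ (edges (K (suc k) t (3 + q)) ⊑ F) →
    ∑ (rsets (2 + q) n) (λ p → tops p * ((deg p ∸ k) ^ k * weight (n !) (deg p)))
      ≤ n ^ suc k * (t * (2 + q) * length (rsets q n) * n !)
  ∑-weights-upper {t} {q} k K-free = begin
    ∑ R (λ p → tops p * ((deg p ∸ k) ^ k * w p))                        ≤⟨ ∑-mono {xs = R} (λ {p} _ → spread p) ⟩
    ∑ R (λ p → ∑ (allFin n) λ x → ∑ (extensions k x) λ S → term p x S)  ≡⟨ ∑-swap R (allFin n) _ ⟩
    ∑ (allFin n) (λ x → ∑ R λ p → ∑ (extensions k x) λ S → term p x S)  ≡⟨ ∑-cong {xs = allFin n} (λ x → ∑-swap R (extensions k x) _) ⟩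
    ∑ (allFin n) (λ x → ∑ (extensions k x) λ S → ∑ R λ p → term p x S)  ≤⟨ ∑-≤-const {xs = allFin n} (λ {x} _ → per-vertex x) ⟩
    length (allFin n) * (n ^ k * U)                                     ≡⟨ cong (_* (n ^ k * U)) (length-allFin n) ⟩
    n * (n ^ k * U)                                                     ≡⟨ *-assoc n (n ^ k) U ⟨
    n ^ suc k * U                                                       ∎
    where
    open ≤-Reasoning
    R = rsets (2 + q) n
    U = t * (2 + q) * length (rsets q n) * n !

    w : Subset n → ℕ
    w p = weight (n !) (deg p)

    term : Subset n → ∀ x → Vec (Fin n) (suc k) → ℕ
    term p x S = ⟦ top? x p ⟧ * (⟦ sel? S p ⟧ * w p)

    per-vertex : ∀ x → ∑ (extensions k x) (λ S → ∑ R λ p → term p x S) ≤ n ^ k * U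
    per-vertex x = ≤-trans
      (∑-≤-const {xs = extensions k x} λ {S} _ → common-link-weight (n !) x S K-free)
      (≤-reflexive (cong (_* U) (length-extensions k x)))

    per-top : ∀ p x → (deg p ∸ k) ^ k * w p * ⟦ top? x p ⟧ ≤ ∑ (extensions k x) (λ S → term p x S)
    per-top p x with top? x p
    ... | no _ = ≤-trans (≤-reflexive (*-zeroʳ ((deg p ∸ k) ^ k * w p))) z≤n
    ... | yes (nb , _) = begin
      (deg p ∸ k) ^ k * w p * 1                                ≡⟨ trans (*-identityʳ _) (*-comm _ (w p)) ⟩
      w p * (deg p ∸ k) ^ k                                    ≤⟨ *-monoʳ-≤ (w p) (extensions-sel k nb k ≤-refl) ⟩
      w p * ∑ (extensions k x) (λ S → ⟦ sel? S p ⟧)            ≡⟨ ∑-distribˡ-* (w p) (extensions k x) _ ⟨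
      ∑ (extensions k x) (λ S → w p * ⟦ sel? S p ⟧)            ≡⟨ ∑-cong {xs = extensions k x} (λ S → trans (*-comm (w p) _) (sym (*-identityˡ _))) ⟩
      ∑ (extensions k x) (λ S → 1 * (⟦ sel? S p ⟧ * w p))      ∎

    spread : ∀ p → tops p * ((deg p ∸ k) ^ k * w p) ≤ ∑ (allFin n) (λ x → ∑ (extensions k x) λ S → term p x S)
    spread p = begin
      tops p * ((deg p ∸ k) ^ k * w p)                         ≡⟨ *-comm (tops p) _ ⟩
      (deg p ∸ k) ^ k * w p * tops p                           ≡⟨ ∑-distribˡ-* ((deg p ∸ k) ^ k * w p) (allFin n) _ ⟨
      ∑ (allFin n) (λ x → (deg p ∸ k) ^ k * w p * ⟦ top? x p ⟧) ≤⟨ ∑-mono {xs = allFin n} (λ {x} _ → per-top p x) ⟩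
      ∑ (allFin n) (λ x → ∑ (extensions k x) λ S → term p x S) ∎

  -- Sum `weighted-power` over all (r-1)-sets: the summands `n !` contribute at most tP and the
  -- weights at most 3tP, with P = n^(2+j+q), both scaled by `n !`, which is cancelled at the end.
  ∑-tops-power : ∀ {t q} j → 1 ≤ t → ¬ (edges (K (2 + j) t (3 + q)) ⊑ F) →
    ∑ (rsets (2 + q) n) (λ p → tops p ^ suc j) ≤ (2 + j) ^ suc j * (4 * t * n ^ (2 + j + q))
  ∑-tops-power {t} {q} j 1≤t K-free = *-cancelˡ-≤ (n !) {{n !≢0}} (begin
    n ! * ∑ R (λ p → tops p ^ suc j)     ≡⟨ ∑-distribˡ-* (n !) R _ ⟨
    ∑ R (λ p → n ! * tops p ^ suc j)     ≤⟨ ∑-mono {xs = R} (λ {p} _ → weighted-power j (tops≤deg p) (deg≤n p)) ⟩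
    ∑ R (λ p → a * (n ! + mass p))       ≡⟨ ∑-distribˡ-* a R _ ⟩
    a * ∑ R (λ p → n ! + mass p)         ≡⟨ cong (a *_) (trans (∑-distrib-+ R _ mass) (cong (_+ ∑ R mass) (∑-const R (n !)))) ⟩
    a * (length R * n ! + ∑ R mass)      ≤⟨ *-monoʳ-≤ a (+-mono-≤ (*-monoˡ-≤ (n !) ∣R∣≤) (∑-weights-upper {t} {q} (suc j) K-free)) ⟩
    a * (t * P * n ! + n ^ (2 + j) * (t * (2 + q) * length (rsets q n) * n !))
                                         ≡⟨ regroup a t P (n !) (n ^ (2 + j)) (2 + q) (length (rsets q n)) ⟩
    n ! * (a * (t * P + t * (n ^ (2 + j) * ((2 + q) * length (rsets q n)))))
                                         ≤⟨ *-monoʳ-≤ (n !) (*-monoʳ-≤ a (+-monoʳ-≤ (t * P) (*-monoʳ-≤ t (*-monoʳ-≤ (n ^ (2 + j)) ([2+k]*length-rsets q n))))) ⟩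
    n ! * (a * (t * P + t * (n ^ (2 + j) * (3 * n ^ q))))
                                         ≡⟨ cong (λ z → n ! * (a * (t * P + z))) (trans (regroup′ t (n ^ (2 + j)) (n ^ q)) (cong (3 * t *_) (sym (^-distribˡ-+-* n (2 + j) q)))) ⟩
    n ! * (a * (t * P + 3 * t * P))      ≡⟨ cong (λ z → n ! * (a * z)) (collect t P) ⟩
    n ! * (a * (4 * t * P))              ∎)
    where
    open ≤-Reasoning
    R = rsets (2 + q) n
    a = (2 + j) ^ suc j
    P = n ^ (2 + j + q)

    mass : Subset n → ℕ
    mass p = tops p * ((deg p ∸ suc j) ^ suc j * weight (n !) (deg p))

    -- Successor exponents keep the case `m = 0` true, since `0 ^ 0` is 1.
    ^-grow : ∀ m b c → c ≤ b → m ^ suc c ≤ m ^ suc b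
    ^-grow zero    b c _   = z≤n
    ^-grow (suc m) b c c≤b = ^-monoʳ-≤ (suc m) (s≤s c≤b)

    ∣R∣≤ : length R ≤ t * P
    ∣R∣≤ = ≤-trans (length-rsets (2 + q) n) (≤-trans (^-grow n (1 + j + q) (1 + q) (s≤s (m≤n+m q j))) (m≤n*m P t {{>-nonZero 1≤t}}))

    regroup : ∀ a t P N m r l → a * (t * P * N + m * (t * r * l * N)) ≡ N * (a * (t * P + t * (m * (r * l))))
    regroup = solve-∀

    regroup′ : ∀ t m p → t * (m * (3 * p)) ≡ 3 * t * (m * p)
    regroup′ = solve-∀

    collect : ∀ t P → t * P + 3 * t * P ≡ 4 * t * P
    collect = solve-∀

  -- The edges are bounded by the total number of tops, and the power mean inequality over the at
  -- most n^(2+q) sets of size r - 1 reduces this to `∑-tops-power`.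
  free-bound : ∀ {t q} j → 1 ≤ t → Unique F → (∀ {e} → e ∈ˡ F → ∣ e ∣ ≡ 3 + q) →
    ¬ (edges (K (2 + j) t (3 + q)) ⊑ F) →
    length F ^ suc j ≤ (4 * (2 + j)) ^ suc j * t * n ^ ((3 + q) * suc j ∸ 1)
  free-bound {t} {q} j 1≤t F! ∣e∣≡ K-free = begin
    length F ^ suc j                                 ≤⟨ ^-monoˡ-≤ (suc j) (edges≤tops F! ∣e∣≡) ⟩
    ∑ R tops ^ suc j                                 ≤⟨ power-mean R tops j ⟩
    length R ^ j * ∑ R (λ p → tops p ^ suc j)        ≤⟨ *-mono-≤ (^-monoˡ-≤ j (length-rsets (2 + q) n)) (∑-tops-power j 1≤t K-free) ⟩
    (n ^ (2 + q)) ^ j * (a * (4 * t * n ^ (2 + j + q))) ≡⟨ cong (_* (a * (4 * t * n ^ (2 + j + q)))) (^-*-assoc n (2 + q) j) ⟩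
    n ^ ((2 + q) * j) * (a * (4 * t * n ^ (2 + j + q))) ≡⟨ regroup (n ^ ((2 + q) * j)) a t (n ^ (2 + j + q)) ⟩
    4 * a * t * (n ^ ((2 + q) * j) * n ^ (2 + j + q))   ≡⟨ cong (4 * a * t *_) (trans (sym (^-distribˡ-+-* n ((2 + q) * j) (2 + j + q))) (cong (n ^_) (exponent q j))) ⟩
    4 * a * t * n ^ (j + (2 + q) * suc j)            ≤⟨ *-monoˡ-≤ (n ^ (j + (2 + q) * suc j)) (*-monoˡ-≤ t 4a≤) ⟩
    -- The exponent `(3 + q) * suc j ∸ 1` computes to `j + (2 + q) * suc j`.
    (4 * (2 + j)) ^ suc j * t * n ^ (j + (2 + q) * suc j) ∎
    where
    open ≤-Reasoning
    R = rsets (2 + q) n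
    a = (2 + j) ^ suc j

    4a≤ : 4 * a ≤ (4 * (2 + j)) ^ suc j
    -- Since 4 is at most `4 ^ suc j`, the factor 4 fits inside a power with exponent s - 1, giving
    -- the constant 4s.
    4a≤ = ≤-trans (*-monoˡ-≤ a (^-monoʳ-≤ 4 (s≤s (z≤n {j})))) (≤-reflexive (sym (^-distribʳ-* 4 (2 + j) (suc j))))

    regroup : ∀ m a t p → m * (a * (4 * t * p)) ≡ 4 * a * t * (m * p)
    regroup = solve-∀

    exponent : ∀ q j → (2 + q) * j + (2 + j + q) ≡ j + (2 + q) * suc j
    exponent = solve-∀

-- Passing to the extremal number.

-- The maximum defining `ex` is either its default 0, whose positive power is 0, or the length of a
-- listed free family, to which `bound` applies.
ex-pow≤ : ∀ {m r b} {H : Hypergraph r m} k →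
  (∀ F → Unique F → (∀ {e} → e ∈ˡ F → ∣ e ∣ ≡ r) → ¬ (edges H ⊑ F) → length F ^ suc k ≤ b) →
  ex n H ^ suc k ≤ b
ex-pow≤ {n} {r = r} {b} {H} k bound with argmax-sel id 0 (map length (freeFamilies n H))
... | inj₁ ex≡0 = ≤-trans (≤-reflexive (cong (_^ suc k) ex≡0)) z≤n
... | inj₂ ex∈ with F , F∈ , ex≡ ← ∈-map⁻ length ex∈
  with F∈′ , F-free ← ∈-filter⁻ (λ F → ¬? (edges H ⊑? F)) {xs = sublists (rsets r n)} F∈ =
  ≤-trans (≤-reflexive (cong (_^ suc k) ex≡))
    (bound F (sublists-Unique F∈′ (rsets-unique r n)) (All.lookup (sublists-All F∈′ (All.tabulate ∣∣-rsets))) F-free)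

ex-K-bound : ∀ j t q n → 1 ≤ t →
  ex n (K (2 + j) t (3 + q)) ^ suc j ≤ (4 * (2 + j)) ^ suc j * t * n ^ ((3 + q) * suc j ∸ 1)
ex-K-bound j t q n 1≤t = ex-pow≤ {H = K (2 + j) t (3 + q)} j λ F → free-bound F j 1≤t

-- Both sides are raised to the power s - 1, which clears the fractional exponents: t^(1/(s-1))
-- becomes t, and n^(r-1/(s-1)) becomes n^(r(s-1)-1).
theorem1p1 : (∀ (s : ℕ) → 2 ≤ s →
    ∃[ C ] (∀ (t r n : ℕ) .{{_ : NonZero r}} → 2 ≤ t → 3 ≤ r → 1 ≤ n →
    ex n (K s t r) ^ (s ∸ 1) ≤ C ^ (s ∸ 1) * t * n ^ (r * (s ∸ 1) ∸ 1)))
    × (∃[ C ] (∀ (t n : ℕ) → 2 ≤ t → ex n (K 2 t 3) ≤ C * t * n ^ 2))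
-- For s = 2 and r = 3, that is j = q = 0, the constant 4s is 8, and the exponent of n is 3 · 1 - 1
-- = 2.
theorem1p1 = general , 8 , λ t n 2≤t →
  subst₂ _≤_ (*-identityʳ (ex n (K 2 t 3))) refl (ex-K-bound 0 t 0 n (<⇒≤ 2≤t))
  where
  general : ∀ (s : ℕ) → 2 ≤ s →
    ∃[ C ] (∀ (t r n : ℕ) .{{_ : NonZero r}} → 2 ≤ t → 3 ≤ r → 1 ≤ n →
    ex n (K s t r) ^ (s ∸ 1) ≤ C ^ (s ∸ 1) * t * n ^ (r * (s ∸ 1) ∸ 1))
  general (suc (suc j)) (s≤s (s≤s _)) = 4 * (2 + j) , λ where
    t (suc (suc (suc q))) n 2≤t (s≤s (s≤s (s≤s _))) _ → ex-K-bound j t q n (<⇒≤ 2≤t)
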